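{- Let $n\geq 1$. Let $a_1(n)$ be the number of partitions $\lambda$ of $n$ satisfying the following: - the set of even parts of $\lambda$ has exactly one element, $2^k m$, with $k\ge 1$ and $m$ odd; - the part $2^k m$ occurs in $\lambda$ with odd multiplicity; - $m$ is a part of $\lambda$ whose multiplicity lies between $1$ and $2^k-1$ inclusive. Let $b_1(n)$ be the total number of parts in all partitions of $n$ into distinct parts minus the total number of different parts in all partitions of $n$ into odd parts, where in each partition into odd parts every distinct part value is counted once. Then $a_1(n)=b_1(n)$.
   Context: A partition of $n$ is a non-increasing sequence of positive integers (its parts) summing to $n$. -}

module Defs where

open import Data.Bool using (Bool; true; false; not; _∧_; if_then_else_)
open import Data.Nat using (ℕ; zero; suc; _+_; _*_; _∸_; _≤ᵇ_; _<ᵇ_; _≡ᵇ_; _⊓_)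
open import Data.Nat.Properties using (_≟_)
open import Data.List using (List; []; _∷_; [_]; map; concatMap; filterᵇ; length; applyUpTo; deduplicate)
open import Data.Nat.ListAction using (sum)
open import Data.Bool.ListAction using (all)
open import Data.Product using (_×_; _,_)

isEven : ℕ → Bool
isEven zero = true
isEven (suc zero) = false
isEven (suc (suc n)) = isEven n

isOdd : ℕ → Bool
isOdd n = not (isEven n)

half : ℕ → ℕ
half zero = zero
half (suc zero) = zero
half (suc (suc n)) = suc (half n)

-- A partition is represented as a list of its parts in non-increasing order.
-- partitionsFuel f n b : all partitions of n whose largest part is ≤ b
-- (the fuel f ≥ n guarantees termination; every part is ≥ 1, so f = n suffices).
partitionsFuel : ℕ → ℕ → ℕ → List (List ℕ)
partitionsFuel _ zero _ = [ [] ]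
partitionsFuel zero (suc _) _ = []
partitionsFuel (suc f) n@(suc _) b =
  concatMap (λ k → map (k ∷_) (partitionsFuel f (n ∸ k) k))
            (applyUpTo suc (b ⊓ n))

partitions : ℕ → List (List ℕ)
partitions n = partitionsFuel n n n

mult : ℕ → List ℕ → ℕ
mult x λ′ = length (filterᵇ (x ≡ᵇ_) λ′)

distinctParts : List ℕ → List ℕ
distinctParts = deduplicate _≟_

evenParts : List ℕ → List ℕ
evenParts λ′ = distinctParts (filterᵇ isEven λ′)

-- twoAdicFuel f e = (2^k , m) with e = 2^k * m, m odd (for e ≥ 1, f ≥ e)
twoAdicFuel : ℕ → ℕ → ℕ × ℕ
twoAdicFuel zero e = 1 , e
twoAdicFuel (suc f) zero = 1 , zero
twoAdicFuel (suc f) e@(suc _) with isEven e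
... | false = 1 , e
... | true with twoAdicFuel f (half e)
...   | p , m = 2 * p , m

twoAdic : ℕ → ℕ × ℕ
twoAdic e = twoAdicFuel e e

-- Condition defining a₁(n): exactly one distinct even part e = 2^k m (k ≥ 1, m odd,
-- automatic since e is even and positive), occurring with odd multiplicity, and
-- m is a part with 1 ≤ mult m ≤ 2^k - 1.
condA : List ℕ → Bool
condA λ′ with evenParts λ′
... | e ∷ [] with twoAdic e
...   | p , m = isOdd (mult e λ′) ∧ (1 ≤ᵇ mult m λ′) ∧ (mult m λ′ ≤ᵇ p ∸ 1)
condA λ′ | _ = false

a₁ : ℕ → ℕ
a₁ n = length (filterᵇ condA (partitions n))

strictlyDecreasing : List ℕ → Bool
strictlyDecreasing [] = true
strictlyDecreasing (x ∷ []) = true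
strictlyDecreasing (x ∷ y ∷ xs) = (y <ᵇ x) ∧ strictlyDecreasing (y ∷ xs)

distinctPartitions : ℕ → List (List ℕ)
distinctPartitions n = filterᵇ strictlyDecreasing (partitions n)

oddPartitions : ℕ → List (List ℕ)
oddPartitions n = filterᵇ (all isOdd) (partitions n)

totalPartsDistinct : ℕ → ℕ
totalPartsDistinct n = sum (map length (distinctPartitions n))

totalDiffPartsOdd : ℕ → ℕ
totalDiffPartsOdd n = sum (map (λ λ′ → length (distinctParts λ′)) (oddPartitions n))

{-# OPTIONS --safe #-}
module Submission where

-- Write M(m) for the multiplicity of the odd number m in an odd partition μ.  Glaisher's
-- bijection sends μ to the distinct partition containing 2ᵏm exactly when bit k of M(m) is set,
-- so b₁(n) counts, over all μ and all odd parts m, the set bits of M(m) other than the lowest one.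
-- Such a bit k is described by ⌊M(m) / 2ᵏ⌋ = c being odd and M(m) mod 2ᵏ = r being nonzero;
-- replacing the M(m) copies of m by r copies of m and c copies of 2ᵏm gives exactly the
-- partitions counted by a₁(n).

open import Defs
open import Algebra.Properties.CommutativeSemigroup using (interchange)
open import Data.Bool using (Bool; true; false; not; _∧_; if_then_else_; T)
open import Data.Bool.ListAction using (all)
open import Data.Bool.Properties using (T-≡)
open import Data.List using (List; []; _∷_; _++_; map; length; replicate; filterᵇ; applyUpTo; applyDownFrom; cartesianProduct; foldr)
open import Data.List.Properties
  using (map-∘; map-cong; map-cong-local; map-id-local; length-map; length-++; length-replicate; filter-++)
open import Data.List.Membership.Propositional using (_∈_; find; lose)
open import Data.List.Membership.Propositional.Properties
  using (∈-map⁺; ∈-map⁻; ∈-filter⁺; ∈-filter⁻; ∈-concatMap⁺; ∈-concatMap⁻; ∈-deduplicate⁺; ∈-deduplicate⁻;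
         ∈-applyUpTo⁺; ∈-applyUpTo⁻; ∈-applyDownFrom⁺; ∈-applyDownFrom⁻; ∈-cartesianProduct⁺; ∈-cartesianProduct⁻)
open import Data.List.Membership.Propositional.Properties.WithK using (unique∧set⇒bag)
open import Data.List.Relation.Binary.BagAndSetEquality using (∼bag⇒↭)
open import Data.List.Relation.Binary.Permutation.Propositional using (_↭_)
open import Data.List.Relation.Binary.Permutation.Propositional.Properties using (map⁺; ↭-length)
open import Data.List.Relation.Unary.All as All using ([]; _∷_)
import Data.List.Relation.Unary.All.Properties as All
open import Data.List.Relation.Unary.AllPairs using ([]; _∷_)
import Data.List.Relation.Unary.AllPairs.Properties as AllPairs
open import Data.List.Relation.Unary.Any using (Any; here; there)
open import Data.List.Relation.Unary.Unique.Propositional using (Unique)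
import Data.List.Relation.Unary.Unique.Propositional.Properties as Unique
open import Data.Nat
open import Data.Nat.ListAction using (sum)
open import Data.Nat.ListAction.Properties using (sum-++; sum-↭)
open import Data.Nat.Properties
open import Data.List.Relation.Unary.Unique.DecPropositional.Properties _≟_ using (deduplicate-!)
open import Data.Nat.Tactic.RingSolver using (solve-∀)
open import Data.Product using (_×_; _,_; proj₁; proj₂; ∃)
open import Function using (_∘_; mk⇔; Equivalence)
open import Relation.Binary.Definitions using (tri<; tri≈; tri>)
open import Relation.Binary.PropositionalEquality
open import Relation.Nullary using (yes; no; contradiction; T?)

-- Binary digits

-- Subtraction is put off to the very end: the core identity says that the number of parts in
-- distinct partitions is a₁(n) plus the number of different parts in odd partitions. A bit k in the
-- multiplicity of m is named by the single number e = 2ᵏm in 1..n, and this e survives the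
-- replacement as the only even part, so the bit can be read back from the result. The conditions in
-- a₁ are the digit conditions again: c odd is the odd multiplicity of e, r nonzero is the lower
-- bound for the multiplicity of m, and r < 2ᵏ is the upper bound. Partitions are lists, while all
-- the maps act on multiplicities. A non-increasing list of positive numbers is determined by its
-- multiplicities and can be rebuilt from them, so each map is defined on multiplicity functions and
-- each inverse law is checked one number at a time. Since n < 2ⁿ, the number n itself serves as a
-- bound for all exponents and digit counts.

b2n : Bool → ℕ
b2n b = if b then 1 else 0

b2n≤1 : ∀ b → b2n b ≤ 1
b2n≤1 false = z≤n
b2n≤1 true  = ≤-refl

isEven-2*+ : ∀ x r → isEven (2 * x + r) ≡ isEven r
isEven-2*+ zero    r = refl
isEven-2*+ (suc x) r = trans (cong (λ z → isEven (z + r)) (*-suc 2 x)) (isEven-2*+ x r)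

half-2*+ : ∀ x r → half (2 * x + r) ≡ x + half r
half-2*+ zero    r = refl
half-2*+ (suc x) r = trans (cong (λ z → half (z + r)) (*-suc 2 x)) (cong suc (half-2*+ x r))

isEven-2* : ∀ x → isEven (2 * x) ≡ true
isEven-2* x = trans (cong isEven (sym (+-identityʳ (2 * x)))) (isEven-2*+ x 0)

half-2* : ∀ x → half (2 * x) ≡ x
half-2* x = trans (cong half (sym (+-identityʳ (2 * x)))) (trans (half-2*+ x 0) (+-identityʳ x))

isEven-1+2* : ∀ x → isEven (1 + 2 * x) ≡ false
isEven-1+2* x = trans (cong isEven (+-comm 1 (2 * x))) (isEven-2*+ x 1)

parity+2*half : ∀ n → n ≡ b2n (isOdd n) + 2 * half n
parity+2*half zero          = refl
parity+2*half (suc zero)    = refl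
parity+2*half (suc (suc n)) = begin
  2 + n                                  ≡⟨ cong (2 +_) (parity+2*half n) ⟩
  2 + (b2n (isOdd n) + 2 * half n)       ≡⟨ lem (b2n (isOdd n)) (half n) ⟩
  b2n (isOdd n) + 2 * suc (half n)       ∎
  where
  open ≡-Reasoning
  lem : ∀ b h → 2 + (b + 2 * h) ≡ b + 2 * suc h
  lem = solve-∀

even⇒2*half : ∀ n → isEven n ≡ true → n ≡ 2 * half n
even⇒2*half n ev = trans (parity+2*half n) (cong (λ b → b2n (not b) + 2 * half n) ev)

half-< : ∀ {m n} → m < 2 * n → half m < n
half-< {m} {n} m<2n = *-cancelˡ-< 2 (half m) n (≤-<-trans 2*half≤ m<2n)
  where
  2*half≤ : 2 * half m ≤ m
  2*half≤ = subst (2 * half m ≤_) (sym (parity+2*half m)) (m≤n+m (2 * half m) (b2n (isOdd m)))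

-- Quotient and remainder modulo `2 ^ k`. The recursion strips the lowest binary digit, so
-- inductions on `k` meet only parity and `half`.
quo : ℕ → ℕ → ℕ
quo zero    M = M
quo (suc k) M = quo k (half M)

rem : ℕ → ℕ → ℕ
rem zero    M = 0
rem (suc k) M = b2n (isOdd M) + 2 * rem k (half M)

rem+2^*quo : ∀ k M → rem k M + 2 ^ k * quo k M ≡ M
rem+2^*quo zero    M = +-identityʳ M
rem+2^*quo (suc k) M = begin
  (b + 2 * r) + 2 * 2 ^ k * q    ≡⟨ lem b r (2 ^ k) q ⟩
  b + 2 * (r + 2 ^ k * q)        ≡⟨ cong (λ h → b + 2 * h) (rem+2^*quo k (half M)) ⟩
  b + 2 * half M                 ≡⟨ parity+2*half M ⟨
  M                              ∎
  where
  open ≡-Reasoning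
  b = b2n (isOdd M)
  r = rem k (half M)
  q = quo k (half M)
  lem : ∀ b r p q → (b + 2 * r) + 2 * p * q ≡ b + 2 * (r + p * q)
  lem = solve-∀

rem<2^ : ∀ k M → rem k M < 2 ^ k
rem<2^ zero    M = ≤-refl
rem<2^ (suc k) M = begin
  suc (b2n (isOdd M) + 2 * rem k (half M)) ≤⟨ s≤s (+-monoˡ-≤ _ (b2n≤1 (isOdd M))) ⟩
  2 + 2 * rem k (half M)                   ≡⟨ *-suc 2 _ ⟨
  2 * suc (rem k (half M))                 ≤⟨ *-monoʳ-≤ 2 (rem<2^ k (half M)) ⟩
  2 * 2 ^ k                                ∎
  where open ≤-Reasoning

private
  swap-2* : ∀ r p q → r + 2 * p * q ≡ 2 * (p * q) + r
  swap-2* = solve-∀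

quo-unique : ∀ k r q → r < 2 ^ k → quo k (r + 2 ^ k * q) ≡ q
quo-unique zero    zero q _ = +-identityʳ q
quo-unique zero    (suc r) q (s≤s ())
quo-unique (suc k) r q r< = begin
  quo k (half (r + 2 * 2 ^ k * q))   ≡⟨ cong (quo k ∘ half) (swap-2* r (2 ^ k) q) ⟩
  quo k (half (2 * (2 ^ k * q) + r)) ≡⟨ cong (quo k) (half-2*+ (2 ^ k * q) r) ⟩
  quo k (2 ^ k * q + half r)         ≡⟨ cong (quo k) (+-comm (2 ^ k * q) (half r)) ⟩
  quo k (half r + 2 ^ k * q)         ≡⟨ quo-unique k (half r) q (half-< r<) ⟩
  q                                  ∎
  where open ≡-Reasoning

rem-unique : ∀ k r q → r < 2 ^ k → rem k (r + 2 ^ k * q) ≡ r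
rem-unique k r q r< = +-cancelʳ-≡ _ _ _ (trans (cong (λ z → rem k M + 2 ^ k * z) (sym (quo-unique k r q r<)))
                                               (rem+2^*quo k M))
  where M = r + 2 ^ k * q

quo-< : ∀ k M → M < 2 ^ k → quo k M ≡ 0
quo-< k M M< = trans (cong (quo k) (trans (sym (+-identityʳ M)) (cong (M +_) (sym (*-zeroʳ (2 ^ k))))))
                     (quo-unique k M 0 M<)

bit : ℕ → ℕ → ℕ
bit k M = b2n (isOdd (quo k M))

bit-< : ∀ k M → M < 2 ^ k → bit k M ≡ 0
bit-< k M M< = cong (b2n ∘ isOdd) (quo-< k M M<)

b2n-isOdd-≤1 : ∀ c → c ≤ 1 → b2n (isOdd c) ≡ c
b2n-isOdd-≤1 zero       _ = refl
b2n-isOdd-≤1 (suc zero) _ = refl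
b2n-isOdd-≤1 (suc (suc c)) (s≤s ())

half-≤1 : ∀ c → c ≤ 1 → half c ≡ 0
half-≤1 zero       _ = refl
half-≤1 (suc zero) _ = refl
half-≤1 (suc (suc c)) (s≤s ())

Σ< : ℕ → (ℕ → ℕ) → ℕ
Σ< zero    g = 0
Σ< (suc K) g = g 0 + Σ< K (g ∘ suc)

Σ<-cong : ∀ K {f g : ℕ → ℕ} → (∀ k → k < K → f k ≡ g k) → Σ< K f ≡ Σ< K g
Σ<-cong zero    eq = refl
Σ<-cong (suc K) eq = cong₂ _+_ (eq 0 z<s) (Σ<-cong K (λ k k<K → eq (suc k) (s≤s k<K)))

Σ<-zero : ∀ K {f : ℕ → ℕ} → (∀ k → f k ≡ 0) → Σ< K f ≡ 0
Σ<-zero zero    eq = refl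
Σ<-zero (suc K) eq = cong₂ _+_ (eq 0) (Σ<-zero K (eq ∘ suc))

Σ<-* : ∀ K a (f : ℕ → ℕ) → Σ< K (λ k → a * f k) ≡ a * Σ< K f
Σ<-* zero    a f = sym (*-zeroʳ a)
Σ<-* (suc K) a f = trans (cong (a * f 0 +_) (Σ<-* K a (f ∘ suc))) (sym (*-distribˡ-+ a (f 0) _))

fromBits : ℕ → (ℕ → ℕ) → ℕ
fromBits K c = Σ< K (λ k → 2 ^ k * c k)

fromBits-suc : ∀ K c → fromBits (suc K) c ≡ c 0 + 2 * fromBits K (c ∘ suc)
fromBits-suc K c = cong₂ _+_ (+-identityʳ (c 0))
  (trans (Σ<-cong K (λ k _ → *-assoc 2 (2 ^ k) (c (suc k)))) (Σ<-* K 2 _))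

fromBits-bit : ∀ K M → M < 2 ^ K → fromBits K (λ k → bit k M) ≡ M
fromBits-bit zero    zero M< = refl
fromBits-bit zero    (suc M) (s≤s ())
fromBits-bit (suc K) M M< = begin
  fromBits (suc K) (λ k → bit k M)                         ≡⟨ fromBits-suc K (λ k → bit k M) ⟩
  b2n (isOdd M) + 2 * fromBits K (λ k → bit k (half M))    ≡⟨ cong (λ z → b2n (isOdd M) + 2 * z) (fromBits-bit K (half M) (half-< M<)) ⟩
  b2n (isOdd M) + 2 * half M                               ≡⟨ parity+2*half M ⟨
  M                                                        ∎
  where open ≡-Reasoning

-- A lowest digit that is 0 or 1 equals its own parity and has half 0, so it is read off at k = 0
-- and halving drops it without a carry.
bit-fromBits : ∀ K c → (∀ k → c k ≤ 1) → ∀ k → k < K → bit k (fromBits K c) ≡ c k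
bit-fromBits (suc K) c c≤1 k k<K = trans (cong (bit k) eq) (step k k<K)
  where
  rest = fromBits K (c ∘ suc)
  eq : fromBits (suc K) c ≡ 2 * rest + c 0
  eq = trans (fromBits-suc K c) (+-comm (c 0) _)
  step : ∀ k → k < suc K → bit k (2 * rest + c 0) ≡ c k
  step zero    _ = trans (cong (b2n ∘ not) (isEven-2*+ rest (c 0))) (b2n-isOdd-≤1 (c 0) (c≤1 0))
  step (suc k) (s≤s k<K) = trans
    (cong (bit k) (trans (half-2*+ rest (c 0)) (trans (cong (rest +_) (half-≤1 (c 0) (c≤1 0))) (+-identityʳ rest))))
    (bit-fromBits K (c ∘ suc) (c≤1 ∘ suc) k k<K)

-- A zero remainder means that no bit below `k` is set, so this marks the lowest set bit; `goodBit`
-- marks the other set bits.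
lowBit : ℕ → ℕ → ℕ
lowBit k M = b2n (isOdd (quo k M) ∧ not (1 ≤ᵇ rem k M))

goodBit : ℕ → ℕ → Bool
goodBit k M = isOdd (quo k M) ∧ (1 ≤ᵇ rem k M)

good+low : ∀ k M → bit k M ≡ b2n (goodBit k M) + lowBit k M
good+low k M = lem (isOdd (quo k M)) (1 ≤ᵇ rem k M)
  where
  lem : ∀ a b → b2n a ≡ b2n (a ∧ b) + b2n (a ∧ not b)
  lem false b     = refl
  lem true  false = refl
  lem true  true  = refl

-- A positive number has exactly one lowest set bit.
Σ<-lowBit : ∀ K M → M < 2 ^ K → Σ< K (λ k → lowBit k M) ≡ b2n (1 ≤ᵇ M)
Σ<-lowBit zero    zero M< = refl
Σ<-lowBit zero    (suc M) (s≤s ())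
Σ<-lowBit (suc K) M M< with isEven M in ev
-- For odd `M` the bit k = 0 is the lowest one; every later remainder contains the digit 1, so all
-- other terms vanish.
... | false = trans (cong suc (Σ<-zero K (λ k → lem k (isOdd (quo k (half M)))))) (sym (pos M ev))
  where
  lem : ∀ k a → b2n (a ∧ false) ≡ 0
  lem k false = refl
  lem k true  = refl
  pos : ∀ M → isEven M ≡ false → b2n (1 ≤ᵇ M) ≡ 1
  pos (suc M) _ = refl
-- For even `M` the term at k = 0 vanishes, and doubling a remainder does not change whether it is
-- zero, so the claim passes to `half M`.
... | true = trans (Σ<-cong K (λ k _ → cong (λ b → b2n (isOdd (quo k (half M)) ∧ not b)) (pos2 (rem k (half M)))))
            (trans (Σ<-lowBit K (half M) (half-< M<)) (cong b2n (sym (trans (cong (1 ≤ᵇ_) (even⇒2*half M ev)) (pos2 (half M))))))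
  where
  pos2 : ∀ x → (1 ≤ᵇ 2 * x) ≡ (1 ≤ᵇ x)
  pos2 zero    = refl
  pos2 (suc x) = refl

-- Finite sums

-- The index starts at 1, whereas that of Σ< starts at 0.
Σ≤ : ℕ → (ℕ → ℕ) → ℕ
Σ≤ zero    f = 0
Σ≤ (suc n) f = Σ≤ n f + f (suc n)

Σ≤-cong : ∀ n {f g : ℕ → ℕ} → (∀ i → 1 ≤ i → i ≤ n → f i ≡ g i) → Σ≤ n f ≡ Σ≤ n g
Σ≤-cong zero    eq = refl
Σ≤-cong (suc n) eq = cong₂ _+_ (Σ≤-cong n (λ i 1≤i i≤n → eq i 1≤i (m≤n⇒m≤1+n i≤n))) (eq (suc n) z<s ≤-refl)

Σ≤-zero : ∀ n {f : ℕ → ℕ} → (∀ i → 1 ≤ i → i ≤ n → f i ≡ 0) → Σ≤ n f ≡ 0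
Σ≤-zero n eq = trans (Σ≤-cong n eq) (zeros n)
  where
  zeros : ∀ n → Σ≤ n (λ _ → 0) ≡ 0
  zeros zero    = refl
  zeros (suc n) = trans (+-identityʳ _) (zeros n)

Σ≤-+ : ∀ n (f g : ℕ → ℕ) → Σ≤ n (λ i → f i + g i) ≡ Σ≤ n f + Σ≤ n g
Σ≤-+ zero    f g = refl
Σ≤-+ (suc n) f g = trans (cong (_+ (f (suc n) + g (suc n))) (Σ≤-+ n f g)) (interchange +-commutativeSemigroup (Σ≤ n f) (Σ≤ n g) (f (suc n)) (g (suc n)))

term≤Σ≤ : ∀ n (f : ℕ → ℕ) i → 1 ≤ i → i ≤ n → f i ≤ Σ≤ n f
term≤Σ≤ zero    f zero () i≤n
term≤Σ≤ (suc n) f i 1≤i i≤n with i ≟ suc n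
... | yes refl = m≤n+m _ _
... | no i≢    = ≤-trans (term≤Σ≤ n f i 1≤i (s≤s⁻¹ (≤∧≢⇒< i≤n i≢))) (m≤m+n _ _)

Σ≤-extend : ∀ n d {f : ℕ → ℕ} → (∀ i → n < i → f i ≡ 0) → Σ≤ (d + n) f ≡ Σ≤ n f
Σ≤-extend n zero    van = refl
Σ≤-extend n (suc d) van = trans (cong₂ _+_ (Σ≤-extend n d van) (van _ (s≤s (m≤n+m n d)))) (+-identityʳ _)

update : ℕ → ℕ → (ℕ → ℕ) → ℕ → ℕ
update j v f x = if x ≡ᵇ j then v else f x

≡ᵇ-refl : ∀ j → (j ≡ᵇ j) ≡ true
≡ᵇ-refl zero    = refl
≡ᵇ-refl (suc j) = ≡ᵇ-refl j

≢⇒≡ᵇ : ∀ {x j} → x ≢ j → (x ≡ᵇ j) ≡ false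
≢⇒≡ᵇ {x} {j} x≢j with x ≡ᵇ j in eq
... | false = refl
... | true  = contradiction (≡ᵇ⇒≡ x j (subst T (sym eq) _)) x≢j

update-≡ : ∀ j v f → update j v f j ≡ v
update-≡ j v f = cong (if_then v else f j) (≡ᵇ-refl j)

update-≢ : ∀ {j x} v f → x ≢ j → update j v f x ≡ f x
update-≢ {j} {x} v f x≢j = cong (if_then v else f x) (≢⇒≡ᵇ x≢j)

Σ≤-update : ∀ n f j → 1 ≤ j → j ≤ n → Σ≤ n f ≡ Σ≤ n (update j 0 f) + f j
Σ≤-update zero    f zero () j≤n
Σ≤-update (suc n) f j 1≤j j≤n with j ≟ suc n
... | yes refl = cong (_+ f j) (trans (Σ≤-cong n (λ i _ i≤n → sym (update-≢ 0 f (<⇒≢ (s≤s i≤n)))))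
                   (trans (sym (+-identityʳ _)) (cong (Σ≤ n (update j 0 f) +_) (sym (update-≡ j 0 f)))))
... | no j≢ = begin
  Σ≤ n f + f (suc n)                                    ≡⟨ cong₂ _+_ (Σ≤-update n f j 1≤j (s≤s⁻¹ (≤∧≢⇒< j≤n j≢))) (sym (update-≢ 0 f (j≢ ∘ sym))) ⟩
  (Σ≤ n (update j 0 f) + f j) + update j 0 f (suc n)    ≡⟨ lem (Σ≤ n (update j 0 f)) (f j) (update j 0 f (suc n)) ⟩
  (Σ≤ n (update j 0 f) + update j 0 f (suc n)) + f j    ∎
  where
  open ≡-Reasoning
  lem : ∀ a b c → (a + b) + c ≡ (a + c) + b
  lem = solve-∀

-- Needed for the sum of a partition when copies move between a number and its odd part: both sums
-- split into the two affected terms and a remainder in which these terms are set to 0.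
Σ≤-replace-two : ∀ n (f g : ℕ → ℕ) {i j} → 1 ≤ i → i ≤ n → 1 ≤ j → j ≤ n → i ≢ j →
                (∀ x → x ≢ i → x ≢ j → f x ≡ g x) → f i + f j ≡ g i + g j → Σ≤ n f ≡ Σ≤ n g
Σ≤-replace-two n f g {i} {j} 1≤i i≤n 1≤j j≤n i≢j agree eq = begin
  Σ≤ n f                                            ≡⟨ split f ⟩
  Σ≤ n (update j 0 (update i 0 f)) + (f i + f j)    ≡⟨ cong₂ _+_ (Σ≤-cong n (λ x _ _ → rest x)) eq ⟩
  Σ≤ n (update j 0 (update i 0 g)) + (g i + g j)    ≡⟨ split g ⟨
  Σ≤ n g                                            ∎
  where
  open ≡-Reasoning
  lem : ∀ a b c → (a + b) + c ≡ a + (c + b)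
  lem = solve-∀
  split : ∀ h → Σ≤ n h ≡ Σ≤ n (update j 0 (update i 0 h)) + (h i + h j)
  split h = begin
    Σ≤ n h                                                            ≡⟨ Σ≤-update n h i 1≤i i≤n ⟩
    Σ≤ n (update i 0 h) + h i                                         ≡⟨ cong (_+ h i) (Σ≤-update n _ j 1≤j j≤n) ⟩
    (Σ≤ n (update j 0 (update i 0 h)) + update i 0 h j) + h i         ≡⟨ cong (λ z → (Σ≤ n (update j 0 (update i 0 h)) + z) + h i) (update-≢ 0 h (i≢j ∘ sym)) ⟩
    (Σ≤ n (update j 0 (update i 0 h)) + h j) + h i                    ≡⟨ lem _ (h j) (h i) ⟩
    Σ≤ n (update j 0 (update i 0 h)) + (h i + h j)                    ∎
  rest : ∀ x → update j 0 (update i 0 f) x ≡ update j 0 (update i 0 g) x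
  rest x with x ≟ i
  ... | yes refl = cong (if x ≡ᵇ j then 0 else_) (trans (update-≡ x 0 f) (sym (update-≡ x 0 g)))
  ... | no x≢i with x ≟ j
  ...   | yes refl = trans (update-≡ x 0 (update i 0 f)) (sym (update-≡ x 0 (update i 0 g)))
  ...   | no x≢j = cong (if x ≡ᵇ j then 0 else_) (trans (update-≢ 0 f x≢i) (trans (agree x x≢i x≢j) (sym (update-≢ 0 g x≢i))))

onOdd : (ℕ → ℕ) → ℕ → ℕ
onOdd f m with isOdd m
... | true  = f m
... | false = 0

onOdd-cong : ∀ {f g : ℕ → ℕ} m → (isOdd m ≡ true → f m ≡ g m) → onOdd f m ≡ onOdd g m
onOdd-cong m eq with isOdd m
... | true  = eq refl
... | false = refl

Σ≤-even : ∀ n (f : ℕ → ℕ) → Σ≤ (2 * n) (λ e → if isOdd e then 0 else f e) ≡ Σ≤ n (λ e → f (2 * e))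
Σ≤-even zero    f = refl
Σ≤-even (suc n) f = begin
  Σ≤ (2 * suc n) h                                   ≡⟨ cong (λ N → Σ≤ N h) (*-suc 2 n) ⟩
  (Σ≤ (2 * n) h + h (1 + 2 * n)) + h (2 + 2 * n)     ≡⟨ cong₂ (λ a b → (Σ≤ (2 * n) h + a) + b) odd even ⟩
  (Σ≤ (2 * n) h + 0) + f (2 + 2 * n)                 ≡⟨ cong₂ _+_ (+-identityʳ _) (cong f (sym (*-suc 2 n))) ⟩
  Σ≤ (2 * n) h + f (2 * suc n)                       ≡⟨ cong (_+ f (2 * suc n)) (Σ≤-even n f) ⟩
  Σ≤ n (λ e → f (2 * e)) + f (2 * suc n)             ∎
  where
  open ≡-Reasoning
  h = λ e → if isOdd e then 0 else f e
  odd : h (1 + 2 * n) ≡ 0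
  odd = cong (λ b → if not b then 0 else f (1 + 2 * n)) (isEven-1+2* n)
  even : h (2 + 2 * n) ≡ f (2 + 2 * n)
  even = cong (λ b → if not b then 0 else f (2 + 2 * n)) (isEven-2* n)

-- Because `f` vanishes beyond `n`, its sum over even numbers may be extended to `2 * n`, where
-- halving the index makes it a sum over 1..n.
Σ≤-parity : ∀ n (f : ℕ → ℕ) → (∀ e → n < e → f e ≡ 0) → Σ≤ n f ≡ Σ≤ n (onOdd f) + Σ≤ n (λ e → f (2 * e))
Σ≤-parity n f van = begin
  Σ≤ n f                                    ≡⟨ Σ≤-cong n (λ e _ _ → split e) ⟩
  Σ≤ n (λ e → onOdd f e + h e)              ≡⟨ Σ≤-+ n (onOdd f) h ⟩
  Σ≤ n (onOdd f) + Σ≤ n h                    ≡⟨ cong (Σ≤ n (onOdd f) +_) (sym (Σ≤-extend n (n + 0) van-h)) ⟩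
  Σ≤ n (onOdd f) + Σ≤ (n + 0 + n) h          ≡⟨ cong (λ N → Σ≤ n (onOdd f) + Σ≤ N h) (+-comm (n + 0) n) ⟩
  Σ≤ n (onOdd f) + Σ≤ (2 * n) h              ≡⟨ cong (Σ≤ n (onOdd f) +_) (Σ≤-even n f) ⟩
  Σ≤ n (onOdd f) + Σ≤ n (λ e → f (2 * e))    ∎
  where
  open ≡-Reasoning
  h = λ e → if isOdd e then 0 else f e
  split : ∀ e → f e ≡ onOdd f e + h e
  split e with isOdd e
  ... | true  = sym (+-identityʳ (f e))
  ... | false = refl
  van-h : ∀ e → n < e → h e ≡ 0
  van-h e n<e with isOdd e
  ... | true  = refl
  ... | false = van e n<e

-- Every positive integer is 2 ^ k * m for exactly one k and odd m.
Σ≤-regroup : ∀ K n (f : ℕ → ℕ) → (∀ e → n < e → f e ≡ 0) → (∀ e → 2 ^ K ≤ e → f e ≡ 0) →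
            Σ≤ n f ≡ Σ≤ n (onOdd (λ m → Σ< K (λ k → f (2 ^ k * m))))
Σ≤-regroup zero    n f van van2 = trans (Σ≤-zero n (λ e 1≤e _ → van2 e 1≤e)) (sym (Σ≤-zero n (λ e _ _ → lem e)))
  where
  lem : ∀ m → onOdd (λ _ → 0) m ≡ 0
  lem m with isOdd m
  ... | true  = refl
  ... | false = refl
Σ≤-regroup (suc K) n f van van2 = begin
  Σ≤ n f                                    ≡⟨ Σ≤-parity n f van ⟩
  -- The odd numbers supply the terms with k = 0. The even ones are an instance for `f′`, which
  -- already vanishes from `2 ^ K` on.
  Σ≤ n (onOdd f) + Σ≤ n f′                   ≡⟨ cong (Σ≤ n (onOdd f) +_) (Σ≤-regroup K n f′ van′ van2′) ⟩
  Σ≤ n (onOdd f) + Σ≤ n (onOdd g)            ≡⟨ Σ≤-+ n (onOdd f) (onOdd g) ⟨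
  Σ≤ n (λ m → onOdd f m + onOdd g m)        ≡⟨ Σ≤-cong n (λ m _ _ → join m) ⟩
  Σ≤ n (onOdd (λ m → Σ< (suc K) (λ k → f (2 ^ k * m)))) ∎
  where
  open ≡-Reasoning
  f′ = λ e → f (2 * e)
  g = λ m → Σ< K (λ k → f′ (2 ^ k * m))
  van′ : ∀ e → n < e → f′ e ≡ 0
  van′ e n<e = van (2 * e) (<-≤-trans n<e (m≤m+n e _))
  van2′ : ∀ e → 2 ^ K ≤ e → f′ e ≡ 0
  van2′ e le = van2 (2 * e) (*-monoʳ-≤ 2 le)
  join : ∀ m → onOdd f m + onOdd g m ≡ onOdd (λ m → Σ< (suc K) (λ k → f (2 ^ k * m))) m
  join m with isOdd m
  ... | false = refl
  ... | true  = cong₂ _+_ (cong f (sym (+-identityʳ m)))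
    (Σ<-cong K (λ k _ → cong f (sym (*-assoc 2 (2 ^ k) m))))

-- Counting through bijections between duplicate-free lists

module _ {A B : Set} {xs : List A} {ys : List B} (φ : A → B) (ψ : B → A)
         (uxs : Unique xs) (uys : Unique ys)
         (φ-∈ : ∀ {x} → x ∈ xs → φ x ∈ ys) (ψ-∈ : ∀ {y} → y ∈ ys → ψ y ∈ xs)
         (ψφ : ∀ {x} → x ∈ xs → ψ (φ x) ≡ x) (φψ : ∀ {y} → y ∈ ys → φ (ψ y) ≡ y) where

  bijection-↭ : map φ xs ↭ ys
  bijection-↭ = ∼bag⇒↭ (unique∧set⇒bag unique-map uys (mk⇔ to from))
    where
    unique-map : Unique (map φ xs)
    -- Injectivity of `φ` is known on the entries of `xs`: mapping `ψ` over the image gives back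
    -- `xs`, which has no duplicates.
    unique-map = Unique.map⁻ {f = ψ} (subst Unique
      (sym (trans (sym (map-∘ xs)) (map-id-local (All.tabulate ψφ)))) uxs)
    to : ∀ {y} → y ∈ map φ xs → y ∈ ys
    to y∈ with ∈-map⁻ φ y∈
    ... | _ , x∈ , refl = φ-∈ x∈
    from : ∀ {y} → y ∈ ys → y ∈ map φ xs
    from y∈ = subst (_∈ map φ xs) (φψ y∈) (∈-map⁺ φ (ψ-∈ y∈))

  sum-bijection : ∀ (g : B → ℕ) → sum (map g ys) ≡ sum (map (g ∘ φ) xs)
  sum-bijection g = trans (sym (sum-↭ (map⁺ g bijection-↭))) (cong sum (sym (map-∘ xs)))

  length-bijection : length xs ≡ length ys
  length-bijection = trans (sym (length-map φ xs)) (↭-length bijection-↭)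

∈-filterᵇ⁺ : ∀ {A : Set} (p : A → Bool) {x xs} → x ∈ xs → p x ≡ true → x ∈ filterᵇ p xs
∈-filterᵇ⁺ p x∈ px = ∈-filter⁺ (T? ∘ p) x∈ (Equivalence.from T-≡ px)

∈-filterᵇ⁻ : ∀ {A : Set} (p : A → Bool) {x xs} → x ∈ filterᵇ p xs → x ∈ xs × p x ≡ true
∈-filterᵇ⁻ p {xs = xs} x∈ with ∈-filter⁻ (T? ∘ p) {xs = xs} x∈
... | x∈xs , Tpx = x∈xs , Equivalence.to T-≡ Tpx

∧-true⁻ : ∀ {a b} → a ∧ b ≡ true → a ≡ true × b ≡ true
∧-true⁻ {true} {true} _ = refl , refl

∧-true⁺ : ∀ {a b} → a ≡ true → b ≡ true → a ∧ b ≡ true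
∧-true⁺ refl refl = refl

isOdd⇒¬isEven : ∀ m → isOdd m ≡ true → isEven m ≡ false
isOdd⇒¬isEven m odd with isEven m
... | false = refl

≤ᵇ-true : ∀ {m n} → m ≤ n → (m ≤ᵇ n) ≡ true
≤ᵇ-true = Equivalence.to T-≡ ∘ ≤⇒≤ᵇ

≤ᵇ-true⁻ : ∀ {m n} → (m ≤ᵇ n) ≡ true → m ≤ n
≤ᵇ-true⁻ {m} {n} = ≤ᵇ⇒≤ m n ∘ Equivalence.from T-≡

-- Multiplicities

mult-∷ : ∀ x y ys → mult x (y ∷ ys) ≡ b2n (x ≡ᵇ y) + mult x ys
mult-∷ x y ys with x ≡ᵇ y
... | true  = refl
... | false = refl

mult-here : ∀ x ys → mult x (x ∷ ys) ≡ suc (mult x ys)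
mult-here x ys = trans (mult-∷ x x ys) (cong (λ b → b2n b + mult x ys) (≡ᵇ-refl x))

mult-there : ∀ {x y} ys → x ≢ y → mult x (y ∷ ys) ≡ mult x ys
mult-there {x} {y} ys x≢y = trans (mult-∷ x y ys) (cong (λ b → b2n b + mult x ys) (≢⇒≡ᵇ x≢y))

∈⇒1≤mult : ∀ {x xs} → x ∈ xs → 1 ≤ mult x xs
∈⇒1≤mult {x} {.x ∷ xs} (here refl) = subst (1 ≤_) (sym (mult-here x xs)) z<s
∈⇒1≤mult {x} {y ∷ xs} (there x∈) = subst (1 ≤_) (sym (mult-∷ x y xs)) (≤-trans (∈⇒1≤mult x∈) (m≤n+m _ (b2n (x ≡ᵇ y))))

1≤mult⇒∈ : ∀ {x xs} → 1 ≤ mult x xs → x ∈ xs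
1≤mult⇒∈ {x} {y ∷ ys} 1≤ with x ≟ y
... | yes refl = here refl
... | no x≢y   = there (1≤mult⇒∈ (subst (1 ≤_) (mult-there ys x≢y) 1≤))

mult-++ : ∀ x xs ys → mult x (xs ++ ys) ≡ mult x xs + mult x ys
mult-++ x xs ys = trans (cong length (filter-++ (T? ∘ (x ≡ᵇ_)) xs ys)) (length-++ (filterᵇ (x ≡ᵇ_) xs))

mult-replicate-≡ : ∀ x j → mult x (replicate j x) ≡ j
mult-replicate-≡ x zero    = refl
mult-replicate-≡ x (suc j) = trans (mult-here x _) (cong suc (mult-replicate-≡ x j))

mult-replicate-≢ : ∀ {x y} j → x ≢ y → mult x (replicate j y) ≡ 0
mult-replicate-≢ zero    x≢y = refl
mult-replicate-≢ (suc j) x≢y = trans (mult-there _ x≢y) (mult-replicate-≢ j x≢y)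

-- Non-increasing lists of positive integers

data Desc : ℕ → List ℕ → Set where
  []   : ∀ {b} → Desc b []
  cons : ∀ {b k xs} → 1 ≤ k → k ≤ b → Desc k xs → Desc b (k ∷ xs)

Desc-weaken : ∀ {b c xs} → b ≤ c → Desc b xs → Desc c xs
Desc-weaken b≤c []               = []
Desc-weaken b≤c (cons 1≤k k≤b d) = cons 1≤k (≤-trans k≤b b≤c) d

Desc-head : ∀ {b x xs} → Desc b (x ∷ xs) → Desc x (x ∷ xs)
Desc-head (cons 1≤x _ d) = cons 1≤x ≤-refl d

Desc-∈ : ∀ {b x xs} → Desc b xs → x ∈ xs → 1 ≤ x × x ≤ b
Desc-∈ (cons 1≤k k≤b d) (here refl) = 1≤k , k≤b
Desc-∈ (cons 1≤k k≤b d) (there x∈) with Desc-∈ d x∈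
... | 1≤x , x≤k = 1≤x , ≤-trans x≤k k≤b

mult-outside : ∀ {b xs} x → Desc b xs → b < x → mult x xs ≡ 0
mult-outside {xs = xs} x d b<x with mult x xs in eq
... | zero  = refl
... | suc _ = contradiction (proj₂ (Desc-∈ d (1≤mult⇒∈ {xs = xs} (subst (1 ≤_) (sym eq) z<s)))) (<⇒≱ b<x)

mult-zero : ∀ {b xs} → Desc b xs → mult 0 xs ≡ 0
mult-zero {xs = xs} d with mult 0 xs in eq
... | zero  = refl
... | suc _ with () ← proj₁ (Desc-∈ d (1≤mult⇒∈ {0} {xs} (subst (1 ≤_) (sym eq) z<s)))

private
  -- `y` exceeds the head of the second list, hence all its entries, but it occurs in the first
  -- list.
  larger-head : ∀ {b x y xs ys} → Desc b (y ∷ ys) → Desc x xs → x < y →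
                mult y (y ∷ ys) ≢ mult y (x ∷ xs)
  larger-head {x = x} {y} {xs} {ys} dy dx x<y eq = contradiction
    (trans (sym (trans eq (trans (mult-there xs (>⇒≢ x<y)) (mult-outside y dx x<y)))) (mult-here y ys)) (λ ())

  Desc-ext′ : ∀ {b c xs ys} → Desc b xs → Desc c ys → (∀ x → mult x xs ≡ mult x ys) → xs ≡ ys
  Desc-ext′ [] [] eq = refl
  Desc-ext′ [] (cons {k = y} {ys} _ _ _) eq = contradiction (trans (eq y) (mult-here y ys)) (λ ())
  Desc-ext′ (cons {k = x} {xs} _ _ _) [] eq = contradiction (trans (sym (eq x)) (mult-here x xs)) (λ ())
  Desc-ext′ dx@(cons {k = x} {xs} _ _ d) dy@(cons {k = y} {ys} _ _ d′) eq with <-cmp x y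
  ... | tri< x<y _ _ = contradiction (sym (eq y)) (larger-head dy d x<y)
  ... | tri> _ _ y<x = contradiction (eq x) (larger-head dx d′ y<x)
  ... | tri≈ _ refl _ = cong (x ∷_) (Desc-ext′ d d′ λ z → +-cancelˡ-≡ (b2n (z ≡ᵇ x)) _ _
          (trans (sym (mult-∷ z x xs)) (trans (eq z) (mult-∷ z x ys))))

-- The principle behind all inverse laws below: outside 1..b both multiplicities vanish, and lists
-- with different heads disagree on the multiplicity of the larger head.
Desc-ext : ∀ {b xs ys} → Desc b xs → Desc b ys →
           (∀ x → 1 ≤ x → x ≤ b → mult x xs ≡ mult x ys) → xs ≡ ys
Desc-ext {b} dx dy eq = Desc-ext′ dx dy every
  where
  every : ∀ x → _
  every zero = trans (mult-zero dx) (sym (mult-zero dy))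
  every x@(suc _) with x ≤? b
  ... | yes x≤b = eq x z<s x≤b
  ... | no  x≰b = trans (mult-outside x dx (≰⇒> x≰b)) (sym (mult-outside x dy (≰⇒> x≰b)))

-- Every map between partitions below is `canon` of a transformed multiplicity function, so that
-- sums, lengths and inverses become statements about functions.
canon : ℕ → (ℕ → ℕ) → List ℕ
canon zero    c = []
canon (suc b) c = replicate (c (suc b)) (suc b) ++ canon b c

Desc-canon : ∀ b c → Desc b (canon b c)
Desc-canon zero    c = []
Desc-canon (suc b) c = go (c (suc b))
  where
  go : ∀ j → Desc (suc b) (replicate j (suc b) ++ canon b c)
  go zero    = Desc-weaken (n≤1+n b) (Desc-canon b c)
  go (suc j) = cons z<s ≤-refl (go j)

mult-canon : ∀ b c x → 1 ≤ x → x ≤ b → mult x (canon b c) ≡ c x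
mult-canon zero    c zero () x≤b
mult-canon (suc b) c x 1≤x x≤b with x ≟ suc b
... | yes refl = trans (mult-++ x (replicate (c x) x) _) (trans
        (cong₂ _+_ (mult-replicate-≡ x (c x)) (mult-outside x (Desc-canon b c) ≤-refl)) (+-identityʳ _))
... | no x≢    = trans (mult-++ x (replicate (c (suc b)) (suc b)) _)
        (cong₂ _+_ (mult-replicate-≢ (c (suc b)) x≢) (mult-canon b c x 1≤x (s≤s⁻¹ (≤∧≢⇒< x≤b x≢))))

canon-mult : ∀ {b xs} → Desc b xs → canon b (λ x → mult x xs) ≡ xs
canon-mult {b} d = Desc-ext (Desc-canon b _) d (mult-canon b _)

sum-replicate : ∀ j x → sum (replicate j x) ≡ x * j
sum-replicate zero    x = sym (*-zeroʳ x)
sum-replicate (suc j) x = trans (cong (x +_) (sum-replicate j x)) (sym (*-suc x j))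

sum-canon : ∀ b c → sum (canon b c) ≡ Σ≤ b (λ i → i * c i)
sum-canon zero    c = refl
sum-canon (suc b) c = trans (sum-++ (replicate (c (suc b)) (suc b)) _)
  (trans (cong₂ _+_ (sum-replicate (c (suc b)) (suc b)) (sum-canon b c)) (+-comm _ (Σ≤ b _)))

length-canon : ∀ b c → length (canon b c) ≡ Σ≤ b c
length-canon zero    c = refl
length-canon (suc b) c = trans (length-++ (replicate (c (suc b)) (suc b)))
  (trans (cong₂ _+_ (length-replicate (c (suc b))) (length-canon b c)) (+-comm _ (Σ≤ b c)))

sum-mult : ∀ {b xs} → Desc b xs → sum xs ≡ Σ≤ b (λ i → i * mult i xs)
sum-mult {b} d = trans (cong sum (sym (canon-mult d))) (sum-canon b _)

-- Partitions

IsPartition : ℕ → List ℕ → Set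
IsPartition n xs = Desc n xs × sum xs ≡ n

∈partitionsFuel⁻ : ∀ f n b {xs} → xs ∈ partitionsFuel f n b → Desc b xs × sum xs ≡ n
∈partitionsFuel⁻ f zero b (here refl) = [] , refl
∈partitionsFuel⁻ (suc f) n@(suc _) b xs∈
  with ∈-concatMap⁻ (λ k → map (k ∷_) (partitionsFuel f (n ∸ k) k)) {xs = applyUpTo suc (b ⊓ n)} xs∈
... | any = go any
  where
  go : ∀ {xs} → Any (λ k → xs ∈ map (k ∷_) (partitionsFuel f (n ∸ k) k)) (applyUpTo suc (b ⊓ n)) → Desc b xs × sum xs ≡ n
  go any with find any
  ... | k , k∈ , xs∈ with ∈-applyUpTo⁻ suc k∈ | ∈-map⁻ (k ∷_) xs∈
  ...   | i , i< , refl | ys , ys∈ , refl with ∈partitionsFuel⁻ f (n ∸ k) k ys∈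
  ...     | d , eq = cons z<s (≤-trans i< (m⊓n≤m b n)) d
                   , trans (cong (k +_) eq) (m+[n∸m]≡n (≤-trans i< (m⊓n≤n b n)))

-- Parts are positive, so removing one lowers `n` by at least the one unit of fuel spent; this
-- maintains `n ≤ f`.
∈partitionsFuel⁺ : ∀ f n b {xs} → n ≤ f → Desc b xs → sum xs ≡ n → xs ∈ partitionsFuel f n b
∈partitionsFuel⁺ f zero b n≤f [] eq = here refl
∈partitionsFuel⁺ f zero b n≤f (cons {k = suc k} 1≤k k≤b d) ()
∈partitionsFuel⁺ (suc f) n@(suc n′) b n≤f (cons {k = suc k} {xs} 1≤k k≤b d) eq =
  ∈-concatMap⁺ (λ k → map (k ∷_) (partitionsFuel f (n ∸ k) k))
    (lose (∈-applyUpTo⁺ suc (⊓-glb k≤b k<n))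
       (∈-map⁺ (suc k ∷_) (∈partitionsFuel⁺ f (n′ ∸ k) (suc k)
          (≤-trans (m∸n≤m n′ k) (s≤s⁻¹ n≤f)) d
          (trans (sym (m+n∸m≡n k (sum xs))) (cong (_∸ k) (suc-injective eq))))))
  where
  k<n : k < n
  k<n = subst (suc k ≤_) eq (m≤m+n (suc k) (sum xs))

-- Within a block of the `concatMap` prefixing the head is injective, and lists from different
-- blocks have different heads.
unique-partitionsFuel : ∀ f n b → Unique (partitionsFuel f n b)
unique-partitionsFuel f       zero      b = [] ∷ []
unique-partitionsFuel zero    (suc n)   b = []
unique-partitionsFuel (suc f) n@(suc _) b = Unique.concat⁺
  (All.map⁺ (All.applyUpTo⁺₂ suc (b ⊓ n) λ i →
     Unique.map⁺ (λ { refl → refl }) (unique-partitionsFuel f (n ∸ suc i) (suc i))))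
  (AllPairs.map⁺ (AllPairs.applyUpTo⁺₁ suc (b ⊓ n) λ i<j _ (u , v) → disjoint i<j u v))
  where
  disjoint : ∀ {i j xs} → i < j → xs ∈ map (suc i ∷_) (partitionsFuel f (n ∸ suc i) (suc i)) →
             xs ∈ map (suc j ∷_) (partitionsFuel f (n ∸ suc j) (suc j)) → _
  disjoint i<j u v with ∈-map⁻ _ u | ∈-map⁻ _ v
  ... | _ , _ , refl | _ , _ , refl = n≮n _ i<j

∈partitions⁻ : ∀ n {xs} → xs ∈ partitions n → IsPartition n xs
∈partitions⁻ n = ∈partitionsFuel⁻ n n n

∈partitions⁺ : ∀ {n xs} → IsPartition n xs → xs ∈ partitions n
∈partitions⁺ {n} (d , eq) = ∈partitionsFuel⁺ n n n ≤-refl d eq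

part*mult≤ : ∀ {n xs} i → IsPartition n xs → i * mult i xs ≤ n
part*mult≤ zero _ = z≤n
part*mult≤ {n} {xs} i@(suc _) (d , eq) with i ≤? n
... | yes i≤n = subst (i * mult i xs ≤_) (trans (sym (sum-mult d)) eq) (term≤Σ≤ n (λ i → i * mult i xs) i z<s i≤n)
... | no  i≰n = subst (_≤ n) (sym (trans (cong (i *_) (mult-outside i d (≰⇒> i≰n))) (*-zeroʳ i))) z≤n

canon-partition : ∀ n c → Σ≤ n (λ i → i * c i) ≡ n → IsPartition n (canon n c)
canon-partition n c eq = Desc-canon n c , trans (sum-canon n c) eq

allOdd⁻ : ∀ xs x → all isOdd xs ≡ true → isEven x ≡ true → mult x xs ≡ 0
allOdd⁻ []       x odd ev = refl
allOdd⁻ (y ∷ ys) x odd ev with ∧-true⁻ {isOdd y} odd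
... | oddy , oddys = trans (mult-there ys x≢y) (allOdd⁻ ys x oddys ev)
  where
  x≢y : x ≢ y
  x≢y refl = contradiction (trans (sym ev) (isOdd⇒¬isEven x oddy)) (λ ())

allOdd⁺ : ∀ xs → (∀ x → isEven x ≡ true → mult x xs ≡ 0) → all isOdd xs ≡ true
allOdd⁺ []       _ = refl
allOdd⁺ (y ∷ ys) even≡0 = ∧-true⁺ odd-y (allOdd⁺ ys λ x ev → m+n≡0⇒n≡0 (b2n (x ≡ᵇ y))
                            (trans (sym (mult-∷ x y ys)) (even≡0 x ev)))
  where
  odd-y : isOdd y ≡ true
  odd-y with isEven y in ev
  ... | false = refl
  ... | true  = contradiction (trans (sym (mult-here y ys)) (even≡0 y ev)) (λ ())

strict⁻ : ∀ {b xs} → Desc b xs → strictlyDecreasing xs ≡ true → ∀ x → mult x xs ≤ 1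
strict⁻ [] _ x = z≤n
strict⁻ {xs = y ∷ []} (cons _ _ _) _ x =
  subst (_≤ 1) (sym (trans (mult-∷ x y []) (+-identityʳ _))) (b2n≤1 (x ≡ᵇ y))
strict⁻ {xs = y ∷ z ∷ zs} (cons _ _ d) sd x with ∧-true⁻ {z <ᵇ y} sd
... | z<y , sd′ with x ≟ y
...   | no x≢y   = subst (_≤ 1) (sym (mult-there (z ∷ zs) x≢y)) (strict⁻ d sd′ x)
...   | yes refl = subst (_≤ 1) (sym (trans (mult-here x (z ∷ zs)) (cong suc
          (mult-outside x (Desc-head d) (<ᵇ⇒< z x (Equivalence.from T-≡ z<y)))))) ≤-refl

strict⁺ : ∀ {b xs} → Desc b xs → (∀ x → mult x xs ≤ 1) → strictlyDecreasing xs ≡ true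
strict⁺ {xs = []} _ _ = refl
strict⁺ {xs = y ∷ []} _ _ = refl
strict⁺ {xs = y ∷ z ∷ zs} (cons _ _ d@(cons 1≤z z≤y d′)) ≤1 = ∧-true⁺ (Equivalence.to T-≡ (<⇒<ᵇ (≤∧≢⇒< z≤y z≢y)))
    (strict⁺ d (λ x → ≤-trans (subst (mult x (z ∷ zs) ≤_) (sym (mult-∷ x y (z ∷ zs))) (m≤n+m _ (b2n (x ≡ᵇ y)))) (≤1 x)))
  where
  z≢y : z ≢ y
  z≢y refl = contradiction (subst (_≤ 1) (trans (mult-here z (z ∷ zs)) (cong suc (mult-here z zs))) (≤1 z)) (λ { (s≤s ()) })

-- The deduplicated list and the `canon` of the indicator function of `xs` are duplicate-free with
-- the same entries, so the identity is a bijection between them.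
length-distinctParts : ∀ {b xs} → Desc b xs → length (distinctParts xs) ≡ Σ≤ b (λ i → b2n (1 ≤ᵇ mult i xs))
length-distinctParts {b} {xs} d = trans (length-bijection (λ x → x) (λ x → x)
    (deduplicate-! xs) (unique-canon b c c≤1)
    (λ {x} x∈ → let x∈xs = ∈-deduplicate⁻ _≟_ xs x∈
                    1≤x , x≤b = Desc-∈ d x∈xs
                in 1≤mult⇒∈ (subst (1 ≤_) (sym (trans (mult-canon b c x 1≤x x≤b) (cong b2n (≤ᵇ-true (∈⇒1≤mult x∈xs))))) ≤-refl))
    (λ {x} x∈ → let 1≤x , x≤b = Desc-∈ (Desc-canon b c) x∈
                in ∈-deduplicate⁺ _≟_ (1≤mult⇒∈ (b2n-pos (subst (1 ≤_) (mult-canon b c x 1≤x x≤b) (∈⇒1≤mult x∈)))))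
    (λ _ → refl) (λ _ → refl))
  (length-canon b c)
  where
  c : ℕ → ℕ
  c i = b2n (1 ≤ᵇ mult i xs)
  c≤1 : ∀ i → c i ≤ 1
  c≤1 i = b2n≤1 (1 ≤ᵇ mult i xs)
  b2n-pos : ∀ {m n} → 1 ≤ b2n (m ≤ᵇ n) → m ≤ n
  b2n-pos {m} {n} 1≤ with m ≤ᵇ n in eq
  ... | true = ≤ᵇ-true⁻ eq
  unique-replicate : ∀ j (x : ℕ) → j ≤ 1 → Unique (replicate j x)
  unique-replicate zero       x _ = []
  unique-replicate (suc zero) x _ = [] ∷ []
  unique-replicate (suc (suc j)) x (s≤s ())
  unique-canon : ∀ b c → (∀ i → c i ≤ 1) → Unique (canon b c)
  unique-canon zero    c _  = []
  unique-canon (suc b) c ≤1 = Unique.++⁺ (unique-replicate _ (suc b) (≤1 (suc b))) (unique-canon b c ≤1)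
    λ (u , v) → contradiction (proj₂ (Desc-∈ (Desc-canon b c) v)) (<⇒≱ (≤-reflexive (sym (All.lookup (All.replicate⁺ {P = _≡ suc b} (c (suc b)) refl) u))))

-- Powers of two and odd parts

-- twoAdicFuel of Defs, but returning the exponent k in place of 2 ^ k.
splitFuel : ℕ → ℕ → ℕ × ℕ
splitFuel zero    e = 0 , e
splitFuel (suc f) e with isEven e
... | false = 0 , e
... | true with splitFuel f (half e)
...   | k , m = suc k , m

val : ℕ → ℕ
val e = proj₁ (splitFuel e e)

oddPart : ℕ → ℕ
oddPart e = proj₂ (splitFuel e e)

odd⇒1≤ : ∀ m → isOdd m ≡ true → 1 ≤ m
odd⇒1≤ (suc m) _ = z<s

n<2^n : ∀ n → n < 2 ^ n
n<2^n zero    = ≤-refl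
n<2^n (suc n) = ≤-<-trans (n<2^n n) (^-monoʳ-< 2 (s≤s z<s) (n<1+n n))

isEven-2^1+k* : ∀ k m → isEven (2 ^ suc k * m) ≡ true
isEven-2^1+k* k m = trans (cong isEven (*-assoc 2 (2 ^ k) m)) (isEven-2* (2 ^ k * m))

half-2^1+k* : ∀ k m → half (2 ^ suc k * m) ≡ 2 ^ k * m
half-2^1+k* k m = trans (cong half (*-assoc 2 (2 ^ k) m)) (half-2* (2 ^ k * m))

-- Each factor 2 costs one unit of fuel, so `k` units are enough; `val` and `oddPart` supply the
-- number itself, which is at least `k`.
splitFuel-2^* : ∀ f k m → isOdd m ≡ true → k ≤ f → splitFuel f (2 ^ k * m) ≡ (k , m)
splitFuel-2^* zero    zero    m odd _ = cong (0 ,_) (+-identityʳ m)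
splitFuel-2^* (suc f) zero    m odd _
  rewrite +-identityʳ m | isOdd⇒¬isEven m odd = refl
splitFuel-2^* (suc f) (suc k) m odd (s≤s k≤f)
  rewrite isEven-2^1+k* k m | half-2^1+k* k m | splitFuel-2^* f k m odd k≤f = refl

twoAdicFuel-2^* : ∀ f k m → isOdd m ≡ true → k ≤ f → twoAdicFuel f (2 ^ k * m) ≡ (2 ^ k , m)
twoAdicFuel-2^* zero    zero    m odd _ = cong (1 ,_) (+-identityʳ m)
twoAdicFuel-2^* (suc f) zero    (suc m) odd _
  rewrite +-identityʳ m | isOdd⇒¬isEven (suc m) odd = refl
-- `twoAdicFuel` separates zero from the successors before testing parity, so the product is
-- generalised to a positive `e`.
twoAdicFuel-2^* (suc f) (suc k) m odd (s≤s k≤f) = step (2 ^ suc k * m) (isEven-2^1+k* k m) (half-2^1+k* k m)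
    (≤-trans (m^n>0 2 (suc k)) (m≤m*n (2 ^ suc k) m {{>-nonZero (odd⇒1≤ m odd)}}))
  where
  step : ∀ e → isEven e ≡ true → half e ≡ 2 ^ k * m → 1 ≤ e → twoAdicFuel (suc f) e ≡ (2 ^ suc k , m)
  step (suc e) ev h _ rewrite ev | h | twoAdicFuel-2^* f k m odd k≤f = refl

module _ (k m : ℕ) (odd : isOdd m ≡ true) where
  1≤2^* : 1 ≤ 2 ^ k * m
  1≤2^* = *-mono-≤ (m^n>0 2 k) (odd⇒1≤ m odd)

  2^≤2^* : 2 ^ k ≤ 2 ^ k * m
  2^≤2^* = m≤m*n (2 ^ k) m {{>-nonZero (odd⇒1≤ m odd)}}

  k≤2^* : k ≤ 2 ^ k * m
  k≤2^* = ≤-trans (<⇒≤ (n<2^n k)) 2^≤2^*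

  val-2^* : val (2 ^ k * m) ≡ k
  val-2^* = cong proj₁ (splitFuel-2^* (2 ^ k * m) k m odd k≤2^*)

  oddPart-2^* : oddPart (2 ^ k * m) ≡ m
  oddPart-2^* = cong proj₂ (splitFuel-2^* (2 ^ k * m) k m odd k≤2^*)

  twoAdic-2^* : twoAdic (2 ^ k * m) ≡ (2 ^ k , m)
  twoAdic-2^* = twoAdicFuel-2^* (2 ^ k * m) k m odd k≤2^*

data Factored : ℕ → Set where
  factored : ∀ k m → isOdd m ≡ true → Factored (2 ^ k * m)

factor : ∀ {e} → 1 ≤ e → Factored e
factor {e} = go e e ≤-refl
  where
  half≤ : ∀ f e → suc e ≤ suc f → half (suc e) ≤ f
  half≤ f zero    _       = z≤n
  half≤ f (suc e) (s≤s e<f) = ≤-trans (s≤s (half-≤ e)) e<f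
    where
    half-≤ : ∀ e → half e ≤ e
    half-≤ zero          = z≤n
    half-≤ (suc zero)    = z≤n
    half-≤ (suc (suc e)) = s≤s (m≤n⇒m≤1+n (half-≤ e))
  half-pos : ∀ e → isEven (suc e) ≡ true → 1 ≤ half (suc e)
  half-pos (suc e) _ = z<s
  go : ∀ f e → e ≤ f → 1 ≤ e → Factored e
  go (suc f) e@(suc e′) e≤f _ with isEven e in ev
  ... | false = subst Factored (+-identityʳ e) (factored 0 e (cong not ev))
  ... | true with half e in h | go f (half e) (half≤ f e′ e≤f) (half-pos e′ ev)
  ...   | _ | factored k m odd = subst Factored
            (trans (*-assoc 2 (2 ^ k) m) (trans (cong (2 *_) (sym h)) (sym (even⇒2*half e ev))))
            (factored (suc k) m odd)

record Split (e : ℕ) : Set where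
  field
    isOdd-oddPart : isOdd (oddPart e) ≡ true
    2^val*oddPart : 2 ^ val e * oddPart e ≡ e
    twoAdic≡      : twoAdic e ≡ (2 ^ val e , oddPart e)

split : ∀ {e} → 1 ≤ e → Split e
split 1≤e with factor 1≤e
... | factored k m odd = record
  { isOdd-oddPart = trans (cong isOdd (oddPart-2^* k m odd)) odd
  ; 2^val*oddPart = cong₂ (λ k m → 2 ^ k * m) (val-2^* k m odd) (oddPart-2^* k m odd)
  ; twoAdic≡      = trans (twoAdic-2^* k m odd) (sym (cong₂ (λ k m → 2 ^ k , m) (val-2^* k m odd) (oddPart-2^* k m odd)))
  }

module _ {e : ℕ} (1≤e : 1 ≤ e) where
  open Split (split 1≤e) public

  1≤oddPart : 1 ≤ oddPart e
  1≤oddPart = odd⇒1≤ (oddPart e) isOdd-oddPart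

  oddPart≤ : oddPart e ≤ e
  oddPart≤ = subst (oddPart e ≤_) 2^val*oddPart (m≤n*m (oddPart e) (2 ^ val e) {{m^n≢0 2 (val e)}})

  val< : val e < e
  val< = <-≤-trans (n<2^n (val e)) (subst (2 ^ val e ≤_) 2^val*oddPart
           (2^≤2^* (val e) (oddPart e) isOdd-oddPart))

onOdd-odd : ∀ {f : ℕ → ℕ} m → isOdd m ≡ true → onOdd f m ≡ f m
onOdd-odd m odd with isOdd m
... | true = refl

onOdd-even : ∀ {f : ℕ → ℕ} m → isEven m ≡ true → onOdd f m ≡ 0
onOdd-even m ev with isEven m
... | true = refl

onOdd-≡ : ∀ {f : ℕ → ℕ} {x} m → (isOdd m ≡ true → f m ≡ x) → (isEven m ≡ true → 0 ≡ x) → onOdd f m ≡ x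
onOdd-≡ m odd even with isEven m
... | false = odd refl
... | true  = even refl

OddPartition : ℕ → List ℕ → Set
OddPartition n xs = IsPartition n xs × (∀ x → isEven x ≡ true → mult x xs ≡ 0)

-- A multiplicity is at most `n`, so `n` binary digits represent it in full.
mult<2^ : ∀ {n xs} → IsPartition n xs → ∀ i → 1 ≤ i → mult i xs < 2 ^ n
mult<2^ {n} {xs} p i 1≤i = ≤-<-trans (≤-trans (m≤n*m (mult i xs) i {{>-nonZero 1≤i}}) (part*mult≤ i p)) (n<2^n n)

-- With m the odd part of e, m times its multiplicity is at most n, which is below e = m · 2ᵏ;
-- cancel m. Hence the bits that would produce parts above `n` are zero, and cutting the lists at
-- `n` loses nothing.
mult-oddPart< : ∀ {n xs} → IsPartition n xs → ∀ e → n < e → mult (oddPart e) xs < 2 ^ val e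
mult-oddPart< {n} {xs} p e n<e = *-cancelˡ-< m _ _ (≤-<-trans (part*mult≤ m p)
    (subst (n <_) (trans (sym (2^val*oddPart 1≤e)) (*-comm (2 ^ val e) m)) n<e))
  where
  m = oddPart e
  1≤e = ≤-trans z<s n<e

-- Turns a sum over all e into a sum, for each odd m, over the binary digits of its multiplicity.
-- The arguments of `F` are the number, its exponent and that multiplicity; the vanishing for
-- `M < 2 ^ k` covers all e > n.
Σ≤-regroup-mult : ∀ {n xs} → IsPartition n xs → (F : ℕ → ℕ → ℕ → ℕ) → (∀ e k M → M < 2 ^ k → F e k M ≡ 0) →
  Σ≤ n (λ e → F e (val e) (mult (oddPart e) xs)) ≡ Σ≤ n (onOdd (λ m → Σ< n (λ k → F (2 ^ k * m) k (mult m xs))))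
Σ≤-regroup-mult {n} {xs} p F van = trans
    (Σ≤-regroup n n _ van-n (λ e le → van-n e (<-≤-trans (n<2^n n) le)))
    (Σ≤-cong n (λ m _ _ → onOdd-cong m (λ odd → Σ<-cong n (λ k _ →
      cong₂ (λ k′ m′ → F (2 ^ k * m) k′ (mult m′ xs)) (val-2^* k m odd) (oddPart-2^* k m odd)))))
  where
  van-n : ∀ e → n < e → F e (val e) (mult (oddPart e) xs) ≡ 0
  van-n e n<e = van e (val e) _ (mult-oddPart< p e n<e)

-- Glaisher's bijection

glaisher : ℕ → List ℕ → List ℕ
glaisher n xs = canon n (λ e → bit (val e) (mult (oddPart e) xs))

-- Each part `2 ^ k * m` breaks into `2 ^ k` copies of `m`. Exponents below `n` suffice, since
-- `2 ^ k * m ≤ n` with m odd forces `k < n`.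
collect : ℕ → List ℕ → ℕ → ℕ
collect n xs = onOdd (λ m → fromBits n (λ k → mult (2 ^ k * m) xs))

glaisher⁻¹ : ℕ → List ℕ → List ℕ
glaisher⁻¹ n xs = canon n (collect n xs)

module _ {n : ℕ} {xs : List ℕ} (op : OddPartition n xs) where
  private
    p  = proj₁ op
    ev = proj₂ op

  mult-glaisher : ∀ e → 1 ≤ e → mult e (glaisher n xs) ≡ bit (val e) (mult (oddPart e) xs)
  mult-glaisher e 1≤e with e ≤? n
  ... | yes e≤n = mult-canon n _ e 1≤e e≤n
  ... | no  e≰n = trans (mult-outside e (Desc-canon n _) (≰⇒> e≰n))
                        (sym (bit-< (val e) _ (mult-oddPart< p e (≰⇒> e≰n))))

  -- For a fixed odd m the new parts `2 ^ k * m` weigh m times the binary expansion of its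
  -- multiplicity, which is the weight of m in `xs`.
  glaisher-partition : IsPartition n (glaisher n xs)
  glaisher-partition = canon-partition n _ (begin
    Σ≤ n (λ e → e * bit (val e) (mult (oddPart e) xs))
      ≡⟨ Σ≤-regroup-mult p (λ e k M → e * bit k M) (λ e k M M< → trans (cong (e *_) (bit-< k M M<)) (*-zeroʳ e)) ⟩
    Σ≤ n (onOdd (λ m → Σ< n (λ k → 2 ^ k * m * bit k (mult m xs))))
      ≡⟨ Σ≤-cong n (λ m 1≤m _ → onOdd-≡ m (λ _ → inner m 1≤m) (λ e → sym (trans (cong (m *_) (ev m e)) (*-zeroʳ m)))) ⟩
    Σ≤ n (λ m → m * mult m xs)
      ≡⟨ sum-mult (proj₁ p) ⟨
    sum xs
      ≡⟨ proj₂ p ⟩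
    n ∎)
    where
    open ≡-Reasoning
    lem : ∀ m a b → a * m * b ≡ m * (a * b)
    lem = solve-∀
    inner : ∀ m → 1 ≤ m → Σ< n (λ k → 2 ^ k * m * bit k (mult m xs)) ≡ m * mult m xs
    inner m 1≤m = trans (Σ<-cong n (λ k _ → lem m (2 ^ k) (bit k (mult m xs))))
      (trans (Σ<-* n m _) (cong (m *_) (fromBits-bit n (mult m xs) (mult<2^ p m 1≤m))))

  glaisher-≤1 : ∀ e → mult e (glaisher n xs) ≤ 1
  glaisher-≤1 zero      = ≤-trans (≤-reflexive (mult-zero (proj₁ glaisher-partition))) z≤n
  glaisher-≤1 e@(suc _) = subst (_≤ 1) (sym (mult-glaisher e z<s)) (b2n≤1 _)

  glaisher⁻¹-glaisher : glaisher⁻¹ n (glaisher n xs) ≡ xs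
  glaisher⁻¹-glaisher = Desc-ext (Desc-canon n _) (proj₁ p) λ m 1≤m m≤n → trans (mult-canon n _ m 1≤m m≤n)
    (onOdd-≡ m (λ odd → trans
      (Σ<-cong n (λ k _ → cong (2 ^ k *_) (trans (mult-glaisher (2 ^ k * m) (1≤2^* k m odd))
        (cong₂ (λ k′ m′ → bit k′ (mult m′ xs)) (val-2^* k m odd) (oddPart-2^* k m odd)))))
      (fromBits-bit n (mult m xs) (mult<2^ p m 1≤m))) (λ e → sym (ev m e)))

  -- The length counts set bits. Each odd number occurring in `xs` has exactly one lowest bit, so
  -- these account for the different parts and the good bits are the excess.
  length-glaisher : length (glaisher n xs) ≡
    Σ≤ n (λ e → b2n (goodBit (val e) (mult (oddPart e) xs))) + length (distinctParts xs)
  length-glaisher = begin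
    length (glaisher n xs)                                ≡⟨ length-canon n _ ⟩
    Σ≤ n (λ e → bit (val e) (M e))                         ≡⟨ Σ≤-cong n (λ e _ _ → good+low (val e) (M e)) ⟩
    Σ≤ n (λ e → b2n (goodBit (val e) (M e)) + lowBit (val e) (M e))
                                                          ≡⟨ Σ≤-+ n _ _ ⟩
    Σ≤ n (λ e → b2n (goodBit (val e) (M e))) + Σ≤ n (λ e → lowBit (val e) (M e))
                                                          ≡⟨ cong (Σ≤ n (λ e → b2n (goodBit (val e) (M e))) +_) lows ⟩
    Σ≤ n (λ e → b2n (goodBit (val e) (M e))) + length (distinctParts xs) ∎
    where
    open ≡-Reasoning
    M : ℕ → ℕ
    M e = mult (oddPart e) xs
    lows : Σ≤ n (λ e → lowBit (val e) (M e)) ≡ length (distinctParts xs)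
    lows = begin
      Σ≤ n (λ e → lowBit (val e) (M e))
        ≡⟨ Σ≤-regroup-mult p (λ _ → lowBit) (λ _ k M M< → cong (λ q → b2n (isOdd q ∧ not (1 ≤ᵇ rem k M))) (quo-< k M M<)) ⟩
      Σ≤ n (onOdd (λ m → Σ< n (λ k → lowBit k (mult m xs))))
        ≡⟨ Σ≤-cong n (λ m 1≤m _ → onOdd-≡ m (λ _ → Σ<-lowBit n (mult m xs) (mult<2^ p m 1≤m))
                                       (λ e → sym (cong (λ z → b2n (1 ≤ᵇ z)) (ev m e)))) ⟩
      Σ≤ n (λ m → b2n (1 ≤ᵇ mult m xs))
        ≡⟨ length-distinctParts (proj₁ p) ⟨
      length (distinctParts xs) ∎

module _ {n : ℕ} {xs : List ℕ} (p : IsPartition n xs) where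

  -- Breaking a part into equal copies of its odd part preserves the sum, whatever the
  -- multiplicities.
  glaisher⁻¹-partition : IsPartition n (glaisher⁻¹ n xs)
  glaisher⁻¹-partition = canon-partition n _ (begin
    Σ≤ n (λ m → m * collect n xs m)                                        ≡⟨ Σ≤-cong n (λ m _ _ → push m) ⟩
    Σ≤ n (onOdd (λ m → m * fromBits n (λ k → mult (2 ^ k * m) xs)))        ≡⟨ Σ≤-cong n (λ m _ _ → onOdd-cong m (λ _ → inner m)) ⟨
    Σ≤ n (onOdd (λ m → Σ< n (λ k → 2 ^ k * m * mult (2 ^ k * m) xs)))      ≡⟨ Σ≤-regroup n n _ van (λ e le → van e (<-≤-trans (n<2^n n) le)) ⟨
    Σ≤ n (λ e → e * mult e xs)                                             ≡⟨ sum-mult (proj₁ p) ⟨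
    sum xs                                                                ≡⟨ proj₂ p ⟩
    n                                                                     ∎)
    where
    open ≡-Reasoning
    push : ∀ m → m * collect n xs m ≡ onOdd (λ m → m * fromBits n (λ k → mult (2 ^ k * m) xs)) m
    push m with isOdd m
    ... | true  = refl
    ... | false = *-zeroʳ m
    lem : ∀ m a b → a * m * b ≡ m * (a * b)
    lem = solve-∀
    inner : ∀ m → Σ< n (λ k → 2 ^ k * m * mult (2 ^ k * m) xs) ≡ m * fromBits n (λ k → mult (2 ^ k * m) xs)
    inner m = trans (Σ<-cong n (λ k _ → lem m (2 ^ k) (mult (2 ^ k * m) xs))) (Σ<-* n m _)
    van : ∀ e → n < e → e * mult e xs ≡ 0
    van e n<e = trans (cong (e *_) (mult-outside e (proj₁ p) n<e)) (*-zeroʳ e)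

  glaisher⁻¹-odd : ∀ x → isEven x ≡ true → mult x (glaisher⁻¹ n xs) ≡ 0
  glaisher⁻¹-odd zero _ = mult-zero (Desc-canon n _)
  glaisher⁻¹-odd x@(suc _) ev with x ≤? n
  ... | yes x≤n = trans (mult-canon n _ x z<s x≤n) (onOdd-even x ev)
  ... | no  x≰n = mult-outside x (Desc-canon n _) (≰⇒> x≰n)

  glaisher-glaisher⁻¹ : (∀ x → mult x xs ≤ 1) → glaisher n (glaisher⁻¹ n xs) ≡ xs
  glaisher-glaisher⁻¹ ≤1 = Desc-ext (Desc-canon n _) (proj₁ p) λ e 1≤e e≤n → let m = oddPart e in begin
    mult e (glaisher n (glaisher⁻¹ n xs))                 ≡⟨ mult-canon n _ e 1≤e e≤n ⟩
    bit (val e) (mult m (glaisher⁻¹ n xs))                ≡⟨ cong (bit (val e)) (mult-canon n _ m (1≤oddPart 1≤e) (≤-trans (oddPart≤ 1≤e) e≤n)) ⟩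
    bit (val e) (collect n xs m)                          ≡⟨ cong (bit (val e)) (onOdd-odd m (isOdd-oddPart 1≤e)) ⟩
    -- Distinctness makes the multiplicities genuine binary digits, and `val e < e ≤ n` puts this
    -- digit in range.
    bit (val e) (fromBits n (λ k → mult (2 ^ k * m) xs))  ≡⟨ bit-fromBits n _ (λ k → ≤1 (2 ^ k * m)) (val e) (<-≤-trans (val< 1≤e) e≤n) ⟩
    mult (2 ^ val e * m) xs                               ≡⟨ cong (λ z → mult z xs) (2^val*oddPart 1≤e) ⟩
    mult e xs                                             ∎
    where open ≡-Reasoning

∈oddPartitions⁻ : ∀ n {xs} → xs ∈ oddPartitions n → OddPartition n xs
∈oddPartitions⁻ n {xs} xs∈ with ∈-filterᵇ⁻ (all isOdd) {xs = partitions n} xs∈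
... | xs∈p , odd = ∈partitions⁻ n xs∈p , λ x → allOdd⁻ xs x odd

∈oddPartitions⁺ : ∀ {n xs} → OddPartition n xs → xs ∈ oddPartitions n
∈oddPartitions⁺ {n} {xs} (p , odd) = ∈-filterᵇ⁺ (all isOdd) (∈partitions⁺ p) (allOdd⁺ xs odd)

∈distinctPartitions⁻ : ∀ n {xs} → xs ∈ distinctPartitions n → IsPartition n xs × (∀ x → mult x xs ≤ 1)
∈distinctPartitions⁻ n xs∈ with ∈-filterᵇ⁻ strictlyDecreasing {xs = partitions n} xs∈
... | xs∈p , sd = let p = ∈partitions⁻ n xs∈p in p , strict⁻ (proj₁ p) sd

∈distinctPartitions⁺ : ∀ {n xs} → IsPartition n xs → (∀ x → mult x xs ≤ 1) → xs ∈ distinctPartitions n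
∈distinctPartitions⁺ p ≤1 = ∈-filterᵇ⁺ strictlyDecreasing (∈partitions⁺ p) (strict⁺ (proj₁ p) ≤1)

unique-partitions : ∀ n → Unique (partitions n)
unique-partitions n = unique-partitionsFuel n n n

unique-oddPartitions : ∀ n → Unique (oddPartitions n)
unique-oddPartitions n = Unique.filter⁺ (T? ∘ all isOdd) (unique-partitions n)

totalPartsDistinct≡ : ∀ n → totalPartsDistinct n ≡ sum (map (length ∘ glaisher n) (oddPartitions n))
totalPartsDistinct≡ n = sum-bijection (glaisher n) (glaisher⁻¹ n)
  (unique-oddPartitions n) (Unique.filter⁺ (T? ∘ strictlyDecreasing) (unique-partitions n))
  (λ xs∈ → let op = ∈oddPartitions⁻ n xs∈ in ∈distinctPartitions⁺ (glaisher-partition op) (glaisher-≤1 op))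
  (λ ys∈ → let p = proj₁ (∈distinctPartitions⁻ n ys∈) in ∈oddPartitions⁺ (glaisher⁻¹-partition p , glaisher⁻¹-odd p))
  (λ xs∈ → glaisher⁻¹-glaisher (∈oddPartitions⁻ n xs∈))
  (λ ys∈ → let p , ≤1 = ∈distinctPartitions⁻ n ys∈ in glaisher-glaisher⁻¹ p ≤1)
  length

-- Partitions with one even part

-- The head of the list of even parts; under `condA` that list is a singleton, so the default 0 is
-- not reached.
evenPart : List ℕ → ℕ
evenPart xs = foldr (λ e _ → e) 0 (evenParts xs)

-- `condA` restated through multiplicities and `val`, `oddPart`, so that it can be checked on a
-- `canon` number by number.
record OneEvenPart (xs : List ℕ) (e : ℕ) : Set where
  field
    1≤e        : 1 ≤ e
    e-even     : isEven e ≡ true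
    only-e     : ∀ x → isEven x ≡ true → x ≢ e → mult x xs ≡ 0
    odd-mult   : isOdd (mult e xs) ≡ true
    1≤mult-odd : 1 ≤ mult (oddPart e) xs
    mult-odd<  : mult (oddPart e) xs < 2 ^ val e

∈evenParts⁻ : ∀ {x} xs → x ∈ evenParts xs → x ∈ xs × isEven x ≡ true
∈evenParts⁻ xs x∈ = ∈-filterᵇ⁻ isEven {xs = xs} (∈-deduplicate⁻ _≟_ (filterᵇ isEven xs) x∈)

∈evenParts⁺ : ∀ {x xs} → x ∈ xs → isEven x ≡ true → x ∈ evenParts xs
∈evenParts⁺ x∈ ev = ∈-deduplicate⁺ _≟_ (∈-filterᵇ⁺ isEven x∈ ev)

unique-singleton : ∀ {A : Set} {e : A} {xs} → Unique xs → e ∈ xs → (∀ {x} → x ∈ xs → x ≡ e) → xs ≡ e ∷ []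
unique-singleton {xs = x ∷ []}     _ _ all-e = cong (_∷ []) (all-e (here refl))
unique-singleton {xs = x ∷ y ∷ ys} ((x≢y ∷ _) ∷ _) _ all-e =
  contradiction (trans (all-e (here refl)) (sym (all-e (there (here refl))))) x≢y

condA-∷[] : ∀ xs e p m → evenParts xs ≡ e ∷ [] → twoAdic e ≡ (p , m) →
            condA xs ≡ isOdd (mult e xs) ∧ (1 ≤ᵇ mult m xs) ∧ (mult m xs ≤ᵇ p ∸ 1)
condA-∷[] xs e p m eq eq′ rewrite eq | eq′ = refl

condA⇒evenParts : ∀ xs → condA xs ≡ true → ∃ λ e → evenParts xs ≡ e ∷ []
condA⇒evenParts xs cond with evenParts xs
... | e ∷ [] = e , refl

condA⁻ : ∀ {b xs} → Desc b xs → condA xs ≡ true → OneEvenPart xs (evenPart xs)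
condA⁻ {xs = xs} d cond with condA⇒evenParts xs cond
... | e , eq = subst (OneEvenPart xs) (sym (cong (foldr (λ e _ → e) 0) eq)) record
  { 1≤e        = 1≤e
  ; e-even     = proj₂ (∈evenParts⁻ xs e∈)
  ; only-e     = only
  ; odd-mult   = proj₁ c
  ; 1≤mult-odd = ≤ᵇ-true⁻ (proj₁ (proj₂ c))
  -- Since `2 ^ val e` is positive, the truncated subtraction in `condA` is exact and the bound
  -- becomes a strict inequality.
  ; mult-odd<  = <-≤-trans (s≤s (≤ᵇ-true⁻ (proj₂ (proj₂ c)))) (≤-reflexive (m+[n∸m]≡n (m^n>0 2 (val e))))
  }
  where
  e∈ : e ∈ evenParts xs
  e∈ = subst (e ∈_) (sym eq) (here refl)
  1≤e = proj₁ (Desc-∈ d (proj₁ (∈evenParts⁻ xs e∈)))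
  only : ∀ x → isEven x ≡ true → x ≢ e → mult x xs ≡ 0
  only x ev x≢e with mult x xs in eq′
  ... | zero  = refl
  ... | suc _ with subst (x ∈_) eq (∈evenParts⁺ (1≤mult⇒∈ {x} {xs} (subst (1 ≤_) (sym eq′) z<s)) ev)
  ...   | here x≡e = contradiction x≡e x≢e
  c : isOdd (mult e xs) ≡ true × (1 ≤ᵇ mult (oddPart e) xs) ≡ true × (mult (oddPart e) xs ≤ᵇ 2 ^ val e ∸ 1) ≡ true
  c with ∧-true⁻ {isOdd (mult e xs)} (trans (sym (condA-∷[] xs e _ _ eq (twoAdic≡ 1≤e))) cond)
  ... | c₁ , c₂₃ = c₁ , ∧-true⁻ c₂₃

module _ {xs : List ℕ} {e : ℕ} (one : OneEvenPart xs e) where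
  open OneEvenPart one

  evenParts≡ : evenParts xs ≡ e ∷ []
  evenParts≡ = unique-singleton (deduplicate-! (filterᵇ isEven xs))
    (∈evenParts⁺ (1≤mult⇒∈ {e} {xs} (odd⇒1≤ _ odd-mult)) e-even)
    all-e
    where
    all-e : ∀ {x} → x ∈ evenParts xs → x ≡ e
    all-e {x} x∈ with x ≟ e | ∈evenParts⁻ xs x∈
    ... | yes x≡e | _ = x≡e
    ... | no x≢e  | x∈xs , ev = contradiction (subst (1 ≤_) (only-e x ev x≢e) (∈⇒1≤mult x∈xs)) (λ ())

  evenPart≡ : evenPart xs ≡ e
  evenPart≡ = cong (foldr (λ e _ → e) 0) evenParts≡

  condA⁺ : condA xs ≡ true
  condA⁺ = trans (condA-∷[] xs e _ _ evenParts≡ (twoAdic≡ 1≤e))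
    (∧-true⁺ odd-mult (∧-true⁺ (≤ᵇ-true 1≤mult-odd)
      (≤ᵇ-true (s≤s⁻¹ (≤-trans mult-odd< (≤-reflexive (sym (m+[n∸m]≡n (m^n>0 2 (val e))))))))))

-- Exchanging copies of an even number with copies of its odd part

good : List ℕ → ℕ → Bool
good xs e = goodBit (val e) (mult (oddPart e) xs)

-- Common form of `merge` and `unmerge`, which differ only in the two new multiplicities. For
-- positive even `e` the two updated places are distinct.
redistribute : ℕ → ℕ → ℕ → (ℕ → ℕ) → ℕ → ℕ
redistribute e a b c = update (oddPart e) a (update e b c)

even≢oddPart : ∀ {e} → 1 ≤ e → isEven e ≡ true → e ≢ oddPart e
even≢oddPart {e} 1≤e ev eq = contradiction
  (trans (sym ev) (trans (cong isEven eq) (isOdd⇒¬isEven (oddPart e) (isOdd-oddPart 1≤e)))) (λ ())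

module Redistribute {e : ℕ} (1≤e : 1 ≤ e) (ev : isEven e ≡ true) (a b : ℕ) (c : ℕ → ℕ) where

  at-oddPart : redistribute e a b c (oddPart e) ≡ a
  at-oddPart = update-≡ (oddPart e) a (update e b c)

  at-e : redistribute e a b c e ≡ b
  at-e = trans (update-≢ a (update e b c) (even≢oddPart 1≤e ev)) (update-≡ e b c)

  elsewhere : ∀ {x} → x ≢ oddPart e → x ≢ e → redistribute e a b c x ≡ c x
  elsewhere x≢m x≢e = trans (update-≢ a (update e b c) x≢m) (update-≢ b c x≢e)

  -- The last step of both inverse laws: `c′` belongs to the original partition and `c` to its
  -- image, and restoring the two altered values gives the original back.
  unchanged : ∀ {c′ : ℕ → ℕ} x → (c′ (oddPart e) ≡ a) → (c′ e ≡ b) →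
              (∀ y → y ≢ oddPart e → y ≢ e → c′ y ≡ c y) → redistribute e a b c x ≡ c′ x
  unchanged x eqm eqe eqy with x ≟ oddPart e
  ... | yes refl = trans at-oddPart (sym eqm)
  ... | no x≢m with x ≟ e
  ...   | yes refl = trans at-e (sym eqe)
  ...   | no x≢e   = trans (elsewhere x≢m x≢e) (sym (eqy x x≢m x≢e))

  -- With m the odd part of e = 2ᵏm, u copies of m and v copies of e weigh m(u + 2ᵏv) together, so
  -- preserving u + 2ᵏv preserves the sum.
  partition : ∀ {n} → e ≤ n → a + 2 ^ val e * b ≡ c (oddPart e) + 2 ^ val e * c e →
              Σ≤ n (λ i → i * c i) ≡ n → IsPartition n (canon n (redistribute e a b c))
  partition {n} e≤n eq sum-c = canon-partition n _ (trans
    (Σ≤-replace-two n _ _ (1≤oddPart 1≤e) (≤-trans (oddPart≤ 1≤e) e≤n) 1≤e e≤n (even≢oddPart 1≤e ev ∘ sym)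
      (λ x x≢m x≢e → cong (x *_) (elsewhere x≢m x≢e))
      (trans (cong₂ (λ u v → oddPart e * u + e * v) at-oddPart at-e)
        (trans (weigh a b) (trans (cong (oddPart e *_) eq) (sym (weigh (c (oddPart e)) (c e)))))))
    sum-c)
    where
    lem : ∀ m p u v → m * u + p * m * v ≡ m * (u + p * v)
    lem = solve-∀
    weigh : ∀ u v → oddPart e * u + e * v ≡ oddPart e * (u + 2 ^ val e * v)
    weigh u v = trans (cong (λ z → oddPart e * u + z * v) (sym (2^val*oddPart 1≤e))) (lem (oddPart e) (2 ^ val e) u v)

merge : ℕ → ℕ → List ℕ → List ℕ
merge n e xs = canon n (redistribute e (mult (oddPart e) xs + 2 ^ val e * mult e xs) 0 (λ x → mult x xs))

unmerge : ℕ → ℕ → List ℕ → List ℕ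
unmerge n e xs = canon n (redistribute e (rem (val e) M) (quo (val e) M) (λ x → mult x xs))
  where M = mult (oddPart e) xs

sum≡ : ∀ {n xs} → IsPartition n xs → Σ≤ n (λ i → i * mult i xs) ≡ n
sum≡ (d , eq) = trans (sym (sum-mult d)) eq

module Merge {n e : ℕ} {xs : List ℕ} (p : IsPartition n xs) (one : OneEvenPart xs e) where
  open OneEvenPart one
  private
    m = oddPart e
    k = val e
    M = mult m xs + 2 ^ k * mult e xs
    module R = Redistribute 1≤e e-even M 0 (λ x → mult x xs)

  e≤n : e ≤ n
  e≤n = proj₂ (Desc-∈ (proj₁ p) (1≤mult⇒∈ {e} {xs} (odd⇒1≤ _ odd-mult)))

  merge-partition : IsPartition n (merge n e xs)
  merge-partition = R.partition e≤n (trans (cong (M +_) (*-zeroʳ (2 ^ k))) (+-identityʳ M)) (sum≡ p)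

  mult-merge : ∀ x → 1 ≤ x → x ≤ n → mult x (merge n e xs) ≡ redistribute e M 0 (λ x → mult x xs) x
  mult-merge = mult-canon n _

  mult-merge-oddPart : mult m (merge n e xs) ≡ M
  mult-merge-oddPart = trans (mult-merge m (1≤oddPart 1≤e) (≤-trans (oddPart≤ 1≤e) e≤n)) R.at-oddPart

  merge-odd : ∀ x → isEven x ≡ true → mult x (merge n e xs) ≡ 0
  merge-odd x ev with mult x (merge n e xs) in eq
  ... | zero  = refl
  ... | suc j with Desc-∈ (Desc-canon n _) (1≤mult⇒∈ {x} {merge n e xs} (subst (1 ≤_) (sym eq) z<s))
  ...   | 1≤x , x≤n = trans (sym eq) (trans (mult-merge x 1≤x x≤n) zero-at)
    where
    x≢m : x ≢ m
    x≢m refl = contradiction (trans (sym ev) (isOdd⇒¬isEven m (isOdd-oddPart 1≤e))) (λ ())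
    zero-at : redistribute e M 0 (λ x → mult x xs) x ≡ 0
    zero-at with x ≟ e
    ... | yes refl = R.at-e
    ... | no x≢e   = trans (R.elsewhere x≢m x≢e) (only-e x ev x≢e)

  -- The bound `mult-odd<` makes the old multiplicities of `m` and `e` the remainder and the
  -- quotient of the merged one, so goodness is what `1≤mult-odd` and `odd-mult` assert.
  merge-good : good (merge n e xs) e ≡ true
  merge-good = trans (cong (goodBit k) mult-merge-oddPart)
    (trans (cong₂ (λ q r → isOdd q ∧ (1 ≤ᵇ r)) (quo-unique k _ _ mult-odd<) (rem-unique k _ (mult e xs) mult-odd<))
           (∧-true⁺ odd-mult (≤ᵇ-true 1≤mult-odd)))

  unmerge-merge : unmerge n e (merge n e xs) ≡ xs
  unmerge-merge = Desc-ext (Desc-canon n _) (proj₁ p) λ x 1≤x x≤n → trans (mult-canon n _ x 1≤x x≤n)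
    (trans (cong (λ z → update m (rem k z) (update e (quo k z) (λ y → mult y ys)) x) mult-merge-oddPart)
    (trans (cong₂ (λ r q → redistribute e r q (λ y → mult y ys) x) (rem-unique k _ (mult e xs) mult-odd<) (quo-unique k _ _ mult-odd<))
    (Redistribute.unchanged 1≤e e-even _ _ (λ y → mult y ys) x refl refl unaffected)))
    where
    ys = merge n e xs
    unaffected : ∀ y → y ≢ m → y ≢ e → mult y xs ≡ mult y ys
    unaffected zero _ _ = trans (mult-zero (proj₁ p)) (sym (mult-zero (Desc-canon n _)))
    unaffected y@(suc _) y≢m y≢e with y ≤? n
    ... | yes y≤n = sym (trans (mult-merge y z<s y≤n) (R.elsewhere y≢m y≢e))
    ... | no  y≰n = trans (mult-outside y (proj₁ p) (≰⇒> y≰n)) (sym (mult-outside y (Desc-canon n _) (≰⇒> y≰n)))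

-- With exponent 0 the remainder is 0, which is not good; hence `e` contains a factor 2.
good⇒even : ∀ {e xs} → 1 ≤ e → good xs e ≡ true → isEven e ≡ true
good⇒even {e} {xs} 1≤e g with val e in eq
... | zero  = contradiction (proj₂ (∧-true⁻ {isOdd (mult (oddPart e) xs)} g)) (λ ())
... | suc k = trans (cong isEven (sym (trans (cong (λ k → 2 ^ k * oddPart e) (sym eq)) (2^val*oddPart 1≤e)))) (isEven-2^1+k* k (oddPart e))

module Unmerge {n e : ℕ} {xs : List ℕ} (op : OddPartition n xs) (1≤e : 1 ≤ e) (e≤n : e ≤ n)
               (is-good : good xs e ≡ true) where
  private
    p = proj₁ op
    m = oddPart e
    k = val e
    M = mult m xs
    ev = good⇒even {e} {xs} 1≤e is-good
    module R = Redistribute 1≤e ev (rem k M) (quo k M) (λ x → mult x xs)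
    g : isOdd (quo k M) ≡ true × (1 ≤ᵇ rem k M) ≡ true
    g = ∧-true⁻ is-good

  unmerge-partition : IsPartition n (unmerge n e xs)
  unmerge-partition = R.partition e≤n
    -- In an odd partition the even number `e` has no copies, so the total to be matched is `M`
    -- alone.
    (trans (rem+2^*quo k M) (sym (trans (cong (λ z → M + 2 ^ k * z) (proj₂ op e ev)) (trans (cong (M +_) (*-zeroʳ (2 ^ k))) (+-identityʳ M)))))
    (sum≡ p)

  mult-unmerge-oddPart : mult m (unmerge n e xs) ≡ rem k M
  mult-unmerge-oddPart = trans (mult-canon n _ m (1≤oddPart 1≤e) (≤-trans (oddPart≤ 1≤e) e≤n)) R.at-oddPart

  mult-unmerge-e : mult e (unmerge n e xs) ≡ quo k M
  mult-unmerge-e = trans (mult-canon n _ e 1≤e e≤n) R.at-e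

  mult-unmerge-elsewhere : ∀ y → y ≢ m → y ≢ e → mult y (unmerge n e xs) ≡ mult y xs
  mult-unmerge-elsewhere zero _ _ = trans (mult-zero (Desc-canon n _)) (sym (mult-zero (proj₁ p)))
  mult-unmerge-elsewhere y@(suc _) y≢m y≢e with y ≤? n
  ... | yes y≤n = trans (mult-canon n _ y z<s y≤n) (R.elsewhere y≢m y≢e)
  ... | no  y≰n = trans (mult-outside y (Desc-canon n _) (≰⇒> y≰n)) (sym (mult-outside y (proj₁ p) (≰⇒> y≰n)))

  unmerge-oneEvenPart : OneEvenPart (unmerge n e xs) e
  unmerge-oneEvenPart = record
    { 1≤e        = 1≤e
    ; e-even     = ev
    ; only-e     = λ x evx x≢e → trans (mult-unmerge-elsewhere x
                     (λ { refl → contradiction (trans (sym evx) (isOdd⇒¬isEven m (isOdd-oddPart 1≤e))) (λ ()) }) x≢e)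
                     (proj₂ op x evx)
    ; odd-mult   = trans (cong isOdd mult-unmerge-e) (proj₁ g)
    ; 1≤mult-odd = subst (1 ≤_) (sym mult-unmerge-oddPart) (≤ᵇ-true⁻ (proj₂ g))
    ; mult-odd<  = subst (_< 2 ^ k) (sym mult-unmerge-oddPart) (rem<2^ k M)
    }

  merge-unmerge : merge n e (unmerge n e xs) ≡ xs
  merge-unmerge = Desc-ext (Desc-canon n _) (proj₁ p) λ x 1≤x x≤n → trans (mult-canon n _ x 1≤x x≤n)
    (Redistribute.unchanged 1≤e ev _ _ (λ y → mult y (unmerge n e xs)) x
      (sym (trans (cong₂ (λ r q → r + 2 ^ k * q) mult-unmerge-oddPart mult-unmerge-e) (rem+2^*quo k M)))
      (proj₂ op e ev)
      (λ y y≢m y≢e → sym (mult-unmerge-elsewhere y y≢m y≢e)))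

-- Odd partitions with a chosen good bit

goodPairs : ℕ → List (List ℕ × ℕ)
goodPairs n = filterᵇ (λ (xs , e) → good xs e) (cartesianProduct (oddPartitions n) (applyDownFrom suc n))

∈goodPairs⁻ : ∀ n {xs e} → (xs , e) ∈ goodPairs n → OddPartition n xs × 1 ≤ e × e ≤ n × good xs e ≡ true
∈goodPairs⁻ n xe∈ with ∈-filterᵇ⁻ _ {xs = cartesianProduct (oddPartitions n) (applyDownFrom suc n)} xe∈
... | xe∈× , g with ∈-cartesianProduct⁻ (oddPartitions n) (applyDownFrom suc n) xe∈×
...   | xs∈ , e∈ with ∈-applyDownFrom⁻ suc e∈
...     | _ , i<n , refl = ∈oddPartitions⁻ n xs∈ , z<s , i<n , g

∈goodPairs⁺ : ∀ n {xs e} → OddPartition n xs → 1 ≤ e → e ≤ n → good xs e ≡ true → (xs , e) ∈ goodPairs n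
∈goodPairs⁺ n {xs} {suc e} op _ e<n g = ∈-filterᵇ⁺ (λ (xs , e) → good xs e)
  (∈-cartesianProduct⁺ (∈oddPartitions⁺ op) (∈-applyDownFrom⁺ suc e<n)) g

unique-goodPairs : ∀ n → Unique (goodPairs n)
unique-goodPairs n = Unique.filter⁺ _ (Unique.cartesianProduct⁺ (unique-oddPartitions n)
  (Unique.applyDownFrom⁺₁ suc n λ j<i _ eq → >⇒≢ j<i (suc-injective eq)))

-- The even part is recorded next to the merged partition because merging erases it, and an odd
-- partition may have several good bits.
a₁≡length-goodPairs : ∀ n → a₁ n ≡ length (goodPairs n)
a₁≡length-goodPairs n = length-bijection
  (λ xs → merge n (evenPart xs) xs , evenPart xs) (λ (xs , e) → unmerge n e xs)
  (Unique.filter⁺ (T? ∘ condA) (unique-partitions n)) (unique-goodPairs n)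
  merge-∈ unmerge-∈
  (λ xs∈ → let p , one = ∈A⁻ xs∈ in Merge.unmerge-merge p one)
  merge-unmerge′
  where
  ∈A⁻ : ∀ {xs} → xs ∈ filterᵇ condA (partitions n) → IsPartition n xs × OneEvenPart xs (evenPart xs)
  ∈A⁻ xs∈ with ∈-filterᵇ⁻ condA {xs = partitions n} xs∈
  ... | xs∈p , c = let p = ∈partitions⁻ n xs∈p in p , condA⁻ (proj₁ p) c

  merge-∈ : ∀ {xs} → xs ∈ filterᵇ condA (partitions n) → (merge n (evenPart xs) xs , evenPart xs) ∈ goodPairs n
  merge-∈ xs∈ with ∈A⁻ xs∈
  ... | p , one = ∈goodPairs⁺ n (merge-partition , merge-odd) (OneEvenPart.1≤e one) e≤n merge-good
    where open Merge p one

  unmerge-∈ : ∀ {xe} → xe ∈ goodPairs n → unmerge n (proj₂ xe) (proj₁ xe) ∈ filterᵇ condA (partitions n)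
  unmerge-∈ xe∈ with ∈goodPairs⁻ n xe∈
  ... | op , 1≤e , e≤n , g = ∈-filterᵇ⁺ condA (∈partitions⁺ unmerge-partition) (condA⁺ unmerge-oneEvenPart)
    where open Unmerge op 1≤e e≤n g

  merge-unmerge′ : ∀ {xe} → xe ∈ goodPairs n → let ys = unmerge n (proj₂ xe) (proj₁ xe) in
                   (merge n (evenPart ys) ys , evenPart ys) ≡ xe
  merge-unmerge′ {xs , e} xe∈ with ∈goodPairs⁻ n xe∈
  ... | op , 1≤e , e≤n , g = trans
    (cong (λ e′ → merge n e′ (unmerge n e xs) , e′) (evenPart≡ unmerge-oneEvenPart))
    (cong (_, e) merge-unmerge)
    where open Unmerge op 1≤e e≤n g

-- Summing over all odd partitions

length-filterᵇ-map : ∀ {A B : Set} (p : B → Bool) (f : A → B) xs → length (filterᵇ p (map f xs)) ≡ length (filterᵇ (p ∘ f) xs)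
length-filterᵇ-map p f []       = refl
length-filterᵇ-map p f (x ∷ xs) with p (f x)
... | true  = cong suc (length-filterᵇ-map p f xs)
... | false = length-filterᵇ-map p f xs

length-filterᵇ-× : ∀ {A B : Set} (p : A × B → Bool) xs ys →
  length (filterᵇ p (cartesianProduct xs ys)) ≡ sum (map (λ x → length (filterᵇ (λ y → p (x , y)) ys)) xs)
length-filterᵇ-× p []       ys = refl
length-filterᵇ-× p (x ∷ xs) ys = trans (cong length (filter-++ (T? ∘ p) (map (x ,_) ys) _))
  (trans (length-++ (filterᵇ p (map (x ,_) ys)))
         (cong₂ _+_ (length-filterᵇ-map p (x ,_) ys) (length-filterᵇ-× p xs ys)))

length-filterᵇ-applyDownFrom : ∀ (p : ℕ → Bool) n → length (filterᵇ p (applyDownFrom suc n)) ≡ Σ≤ n (b2n ∘ p)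
length-filterᵇ-applyDownFrom p zero    = refl
length-filterᵇ-applyDownFrom p (suc n) with p (suc n)
... | true  = trans (cong suc (length-filterᵇ-applyDownFrom p n)) (+-comm 1 _)
... | false = trans (length-filterᵇ-applyDownFrom p n) (sym (+-identityʳ _))

sum-map-+ : ∀ {A : Set} (f g : A → ℕ) xs → sum (map (λ x → f x + g x) xs) ≡ sum (map f xs) + sum (map g xs)
sum-map-+ f g []       = refl
sum-map-+ f g (x ∷ xs) = trans (cong (f x + g x +_) (sum-map-+ f g xs)) (interchange +-commutativeSemigroup (f x) (g x) _ _)

totalPartsDistinct≡a₁+ : ∀ n → totalPartsDistinct n ≡ a₁ n + totalDiffPartsOdd n
totalPartsDistinct≡a₁+ n = begin
  totalPartsDistinct n
    ≡⟨ totalPartsDistinct≡ n ⟩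
  sum (map (length ∘ glaisher n) (oddPartitions n))
    ≡⟨ cong sum (map-cong-local (All.tabulate (λ xs∈ → length-glaisher (∈oddPartitions⁻ n xs∈)))) ⟩
  sum (map (λ xs → Σ≤ n (b2n ∘ good xs) + length (distinctParts xs)) (oddPartitions n))
    ≡⟨ sum-map-+ (λ xs → Σ≤ n (b2n ∘ good xs)) (length ∘ distinctParts) (oddPartitions n) ⟩
  sum (map (λ xs → Σ≤ n (b2n ∘ good xs)) (oddPartitions n)) + totalDiffPartsOdd n
    ≡⟨ cong (_+ totalDiffPartsOdd n) (cong sum (map-cong (λ xs → length-filterᵇ-applyDownFrom (good xs) n) (oddPartitions n))) ⟨
  sum (map (λ xs → length (filterᵇ (good xs) (applyDownFrom suc n))) (oddPartitions n)) + totalDiffPartsOdd n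
    -- The pairs are counted one odd partition at a time.
    ≡⟨ cong (_+ totalDiffPartsOdd n) (length-filterᵇ-× _ (oddPartitions n) (applyDownFrom suc n)) ⟨
  length (goodPairs n) + totalDiffPartsOdd n
    ≡⟨ cong (_+ totalDiffPartsOdd n) (a₁≡length-goodPairs n) ⟨
  a₁ n + totalDiffPartsOdd n ∎
  where open ≡-Reasoning

-- Passage to the integers

import Data.Integer as ℤ
open import Data.Integer using (ℤ; +_; _-_)
import Data.Integer.Properties as ℤ

theorem3 : (n : ℕ) → n ≥ 1 → + a₁ n ≡ + totalPartsDistinct n - + totalDiffPartsOdd n
theorem3 n _ = begin
  + a₁ n                                                          ≡⟨ ℤ.+-identityʳ (+ a₁ n) ⟨
  + a₁ n ℤ.+ ℤ.0ℤ                                                   ≡⟨ cong (λ z → + a₁ n ℤ.+ z) (ℤ.+-inverseʳ (+ totalDiffPartsOdd n)) ⟨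
  + a₁ n ℤ.+ (+ totalDiffPartsOdd n - + totalDiffPartsOdd n)      ≡⟨ ℤ.+-assoc (+ a₁ n) (+ totalDiffPartsOdd n) (ℤ.- (+ totalDiffPartsOdd n)) ⟨
  + (a₁ n + totalDiffPartsOdd n) - + totalDiffPartsOdd n          ≡⟨ cong (λ z → + z - + totalDiffPartsOdd n) (totalPartsDistinct≡a₁+ n) ⟨
  + totalPartsDistinct n - + totalDiffPartsOdd n                  ∎
  where open ≡-Reasoning
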